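{- For every integer $n\ge1$, $spt_o(2n)=spt(n)$, where $spt_o(m):=spt_o^{+}(m)-spt_o^{ - }(m)$.
   Context: For a nonempty integer partition $\pi$, let $s(\pi)$ be its smallest part. Call $\pi$ admissible if no odd part of $\pi$ is greater than $2s(\pi)$. $spt_o^{+}(m)$ is the total number of occurrences of the smallest part, summed over all admissible partitions $\pi$ of $m$. For $l\ge1$ let $\delta_l=(l-1,l-2,\dots,1)$ be the triangular partition of size $\binom{l}{2}$; $spt_o^{ - }(m)$ is the total number of occurrences of $s(\pi)$ in $\pi$, summed over all pairs $(\pi,\delta_{s(\pi)})$ where $\pi$ is an admissible partition with $|\pi|+\binom{s(\pi)}{2}=m$. Equivalently, $\sum_{m\ge1}spt_o(m)q^m=\sum_{n\ge1}\frac{q^n(q^{2n+1};q^2)_\infty}{(1-q^n)^2(q^{n+1};q)_\infty}\bigl(1-q^{n(n-1)/2}\bigr)$, with $(a;q)_\infty=\prod_{k\ge0}(1-aq^k)$. $spt(n)$ is Andrews' function: the total number of occurrences of the smallest part, summed over all partitions of $n$. -}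

module Defs where

open import Data.Nat using (ℕ; zero; suc; _+_; _*_; _∸_; _⊓_; _≤ᵇ_; _≡ᵇ_)
open import Data.Nat.Combinatorics using (_C_)
open import Data.Bool using (Bool; true; false; _∧_; _∨_; not; if_then_else_)
open import Data.List using (List; []; _∷_; map; concat; concatMap; filterᵇ; length; upTo; allFin; foldr; applyUpTo)
open import Data.Integer using (ℤ; +_; _-_)
open import Function using (_∘_)
import Data.Nat as ℕ
open import Data.Nat.ListAction using (sum)

listsOf : ℕ → ℕ → List (List ℕ)
listsOf zero    m = [] ∷ []
listsOf (suc L) m = concatMap (λ p → map (p ∷_) (listsOf L m)) (applyUpTo suc m)

candidates : ℕ → List (List ℕ)
candidates m = concatMap (λ L → listsOf L m) (applyUpTo (λ i → i) (suc m))

nonincreasing : List ℕ → Bool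
nonincreasing []           = true
nonincreasing (x ∷ [])     = true
nonincreasing (x ∷ y ∷ xs) = (y ≤ᵇ x) ∧ nonincreasing (y ∷ xs)

allPositive : List ℕ → Bool
allPositive = foldr (λ x b → (1 ≤ᵇ x) ∧ b) true

isPartitionOf : ℕ → List ℕ → Bool
isPartitionOf m π = allPositive π ∧ nonincreasing π ∧ (sum π ≡ᵇ m)

partitions : ℕ → List (List ℕ)
partitions m = filterᵇ (isPartitionOf m) (candidates m)

isNonempty : List ℕ → Bool
isNonempty []      = false
isNonempty (_ ∷ _) = true

-- smallest part s(π) (meaningful for nonempty π)
smallest : List ℕ → ℕ
smallest []       = 0
smallest (x ∷ xs) = foldr _⊓_ x xs

multSmallest : List ℕ → ℕ
multSmallest π = length (filterᵇ (λ p → p ≡ᵇ smallest π) π)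

isOdd : ℕ → Bool
isOdd n = not (ℕ._%_ n 2 ≡ᵇ 0)

admissible : List ℕ → Bool
admissible π = isNonempty π ∧ foldr (λ p b → (not (isOdd p) ∨ (p ≤ᵇ 2 * smallest π)) ∧ b) true π

Σ[_]_ : List (List ℕ) → (List ℕ → ℕ) → ℕ
Σ[ xs ] f = sum (map f xs)

-- spt(n): total number of occurrences of the smallest part over all partitions of n
-- (the empty partition of 0 contributes 0 since it has no parts).
spt : ℕ → ℕ
spt n = Σ[ partitions n ] multSmallest

sptoPlus : ℕ → ℕ
sptoPlus m = Σ[ partitions m ] (λ π → if admissible π then multSmallest π else 0)

sptoMinus : ℕ → ℕ
sptoMinus m = sum (map (λ k → Σ[ partitions k ]
                      (λ π → if admissible π ∧ (k + (smallest π C 2) ≡ᵇ m)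
                             then multSmallest π else 0))
                   (applyUpTo (λ i → i) (suc m)))

spto : ℕ → ℤ
spto m = + sptoPlus m - + sptoMinus m

-- Fix the smallest part n and multiply by (q²;q²)∞.  Admissible partitions with smallest part n,
-- weighted by the multiplicity of n, contribute q^n (q)ₙ₋₁² / ((q)ₙ (q;q²)ₙ), and ordinary partitions
-- with smallest part r, with q replaced by q², contribute q^(2r) (q²;q²)ᵣ₋₁² / (q²;q²)ᵣ.  Insert Euler's
--   1/(q)ₙ = Σ_{j+2r=n} q^(j(j-1)/2) / ((q)ⱼ (q²;q²)ᵣ).
-- The terms with r = 0 carry the factor q^(n(n-1)/2) and cancel the subtracted sum exactly.  For
-- fixed r ≥ 1 the sum over j is evaluated by
--   Σ_j q^(j(j+1)/2) (q)²_{2r+j-1} / ((q)ⱼ (q;q²)_{2r+j}) = (q²;q²)ᵣ₋₁²,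
-- which telescopes for r = 1 and passes from r to r + 1 by a q-Zeilberger certificate.  Hence the
-- series of spto is that of spt at q².  All identities are proved in an arbitrary commutative ring
-- in which q is nilpotent, so that every sum and product is finite.

module Submission where

open import Defs
open import Algebra.Bundles using (CommutativeMonoid; CommutativeRing)
import Algebra.Solver.Ring as RingSolver
open import Algebra.Solver.Ring.AlmostCommutativeRing using (fromCommutativeRing; _-Raw-AlmostCommutative⟶_)
open import Data.Bool as Bool using (Bool; true; false; if_then_else_; not; _∧_; _∨_)
open import Data.Bool.Properties using (∧-comm; ∧-identityʳ; ∧-zeroʳ; ∨-zeroʳ)
open import Data.Integer as ℤ using (ℤ; +_; -[1+_]; +0; +[1+_]; _⊖_; 0ℤ; 1ℤ)
import Data.Integer.Properties as ℤ
open import Data.List using (List; []; _∷_; map; concatMap; filterᵇ; length; applyUpTo; foldr; _++_)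
open import Data.List.Membership.Propositional using (_∈_)
open import Data.List.Properties using (map-++; map-∘)
open import Data.List.Relation.Unary.All as All using (All; []; _∷_)
open import Data.List.Relation.Unary.Any using (here; there)
open import Data.Maybe using (Maybe; just; nothing)
open import Data.Nat as ℕ using (ℕ; zero; suc; _⊓_; _≤_; _<_; _≤′_; _≤ᵇ_; _<ᵇ_; _≡ᵇ_; z≤n; s≤s; ≤′-refl; ≤′-step)
open import Data.Nat.Combinatorics using (_C_; nC1≡n; nCk+nC[k+1]≡[n+1]C[k+1])
open import Data.Nat.DivMod using (m*n%n≡0; [m+kn]%n≡m%n)
open import Data.Nat.ListAction using (sum)
open import Data.Nat.ListAction.Properties using (sum-++)
import Data.Nat.Properties as ℕ
open import Data.Product using (_,_; proj₁; proj₂)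
open import Data.Sum using (inj₁; inj₂)
open import Data.Unit using (tt)
open import Function using (_∘_)
open import Level using (0ℓ)
open import Relation.Binary.Definitions using (tri<; tri≈; tri>)
open import Relation.Binary.PropositionalEquality as ≡ using (_≡_; _≢_; _≗_)
open import Relation.Nullary using (yes; no; contradiction)

-- The sums over j are infinite, and a partial sum misses the closed form by a remainder. Nilpotency
-- alone does not remove it, since the remainder after J terms is only divisible by q^J. But the
-- r-th sum carries the prefactor q^(2r), and summing over smallest parts n ≤ 2k cuts it at J = 2k +
-- 1 - 2r, so prefactor and remainder together reach q^(2k+1) = 0. Divisibility by q^J is expressed
-- through annihilators (a q^J = 0 implies a f = 0), which avoids naming quotients.
--
-- On the combinatorial side, the occurrences of s are counted over all partitions whose parts are
-- at least s and permitted for s. A partition without the part s adds 0, so exactly those with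
-- smallest part s contribute. The statistic thus becomes a linear recursion on nonincreasing lists,
-- `layerℕ`, whose ring version `layer` can be solved in closed form. The recursion runs over the
-- length of the lists; lists too long for the degree in question vanish on both sides.

infixl 7 _⊕_

-- j ⊕ r = j + 2 r, by recursion on r so that sums over j + 2 r = n reduce definitionally.
_⊕_ : ℕ → ℕ → ℕ
j ⊕ zero  = j
j ⊕ suc r = suc (suc (j ⊕ r))

double : ℕ → ℕ
double r = 0 ⊕ r

suc-⊕ : ∀ j r → suc j ⊕ r ≡ suc (j ⊕ r)
suc-⊕ j zero    = ≡.refl
suc-⊕ j (suc r) = ≡.cong (λ n → suc (suc n)) (suc-⊕ j r)

-- triangular n = n (n - 1) / 2.
triangular : ℕ → ℕ
triangular zero    = 0
triangular (suc j) = triangular j ℕ.+ j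

-- Doubling, parity and Boolean comparisons of natural numbers.

double≡n+n : ∀ n → double n ≡ n ℕ.+ n
double≡n+n zero    = ≡.refl
double≡n+n (suc n) = ≡.cong suc (≡.trans (≡.cong suc (double≡n+n n)) (≡.sym (ℕ.+-suc n n)))

n≤double : ∀ n → n ≤ double n
n≤double n = ≡.subst (n ≤_) (≡.sym (double≡n+n n)) (ℕ.m≤m+n n n)

>⇒≢ : ∀ {m n} → n < m → m ≢ n
>⇒≢ n<m m≡n = ℕ.<⇒≢ n<m (≡.sym m≡n)

double≡*2 : ∀ n → double n ≡ n ℕ.* 2
double≡*2 zero    = ≡.refl
double≡*2 (suc n) = ≡.cong (λ k → suc (suc k)) (double≡*2 n)

double≡2* : ∀ n → double n ≡ 2 ℕ.* n
double≡2* n = ≡.trans (double≡*2 n) (ℕ.*-comm n 2)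

isOdd-double : ∀ n → isOdd (double n) ≡ false
isOdd-double n = ≡.cong (λ r → not (r ≡ᵇ 0)) (≡.trans (≡.cong (ℕ._% 2) (double≡*2 n)) (m*n%n≡0 n 2))

isOdd-suc-double : ∀ n → isOdd (suc (double n)) ≡ true
isOdd-suc-double n = ≡.cong (λ r → not (r ≡ᵇ 0)) (≡.trans (≡.cong (λ k → suc k ℕ.% 2) (double≡*2 n)) ([m+kn]%n≡m%n 1 n 2))

double-mono-≤ : ∀ {m n} → m ≤ n → double m ≤ double n
double-mono-≤ z≤n       = z≤n
double-mono-≤ (s≤s m≤n) = s≤s (s≤s (double-mono-≤ m≤n))

≡ᵇ-refl : ∀ n → (n ≡ᵇ n) ≡ true
≡ᵇ-refl zero    = ≡.refl
≡ᵇ-refl (suc n) = ≡ᵇ-refl n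

≢⇒≡ᵇ-false : ∀ m n → m ≢ n → (m ≡ᵇ n) ≡ false
≢⇒≡ᵇ-false zero    zero    m≢n = contradiction ≡.refl m≢n
≢⇒≡ᵇ-false zero    (suc n) m≢n = ≡.refl
≢⇒≡ᵇ-false (suc m) zero    m≢n = ≡.refl
≢⇒≡ᵇ-false (suc m) (suc n) m≢n = ≢⇒≡ᵇ-false m n (λ m≡n → m≢n (≡.cong suc m≡n))

≤⇒≤ᵇ : ∀ {m n} → m ≤ n → (m ≤ᵇ n) ≡ true
≤⇒≤ᵇ z≤n             = ≡.refl
≤⇒≤ᵇ (s≤s z≤n)       = ≡.refl
≤⇒≤ᵇ (s≤s (s≤s m≤n)) = ≤⇒≤ᵇ (s≤s m≤n)

<⇒≤ᵇ-false : ∀ {m n} → n < m → (m ≤ᵇ n) ≡ false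
<⇒≤ᵇ-false {suc zero}    (s≤s z≤n)       = ≡.refl
<⇒≤ᵇ-false {suc (suc m)} (s≤s z≤n)       = ≡.refl
<⇒≤ᵇ-false {suc (suc m)} (s≤s (s≤s n<m)) = <⇒≤ᵇ-false {suc m} (s≤s n<m)

<ᵇ-suc : ∀ m n → (m <ᵇ suc n) ≡ (m ≤ᵇ n)
<ᵇ-suc zero    n = ≡.refl
<ᵇ-suc (suc m) n = ≡.refl

-- Integer coefficients for the ring solver over an arbitrary commutative ring.

module IntegerCoefficients (R : CommutativeRing 0ℓ 0ℓ) where

  open CommutativeRing R hiding (zero)
  open import Algebra.Properties.AbelianGroup +-abelianGroup using (⁻¹-∙-comm)
  open import Algebra.Properties.Group +-group using (ε⁻¹≈ε; ⁻¹-involutive)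
  open import Algebra.Properties.Ring ring using (-‿distribˡ-*; -‿distribʳ-*)
  open import Algebra.Properties.Semiring.Mult.TCOptimised semiring
  open import Relation.Binary.Reasoning.Setoid setoid

  ⟦_⟧ : ℤ → Carrier
  ⟦ + n ⟧      = n × 1#
  ⟦ -[1+ n ] ⟧ = - (suc n × 1#)

  ⟦⟧-cong : ∀ {i j} → i ≡ j → ⟦ i ⟧ ≈ ⟦ j ⟧
  ⟦⟧-cong ≡.refl = refl

  ⟦-⟧ : ∀ i → ⟦ ℤ.- i ⟧ ≈ - ⟦ i ⟧
  ⟦-⟧ +0       = sym ε⁻¹≈ε
  ⟦-⟧ +[1+ n ] = refl
  ⟦-⟧ -[1+ n ] = sym (⁻¹-involutive _)

  cancel-one : ∀ a b → (1# + a) - (1# + b) ≈ a - b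
  cancel-one a b = begin
    (1# + a) - (1# + b)      ≈⟨ +-cong (+-comm 1# a) (sym (⁻¹-∙-comm 1# b)) ⟩
    (a + 1#) + (- 1# + - b)  ≈⟨ +-assoc a 1# _ ⟩
    a + (1# + (- 1# + - b))  ≈⟨ +-congˡ (+-assoc 1# (- 1#) (- b)) ⟨
    a + ((1# - 1#) - b)      ≈⟨ +-congˡ (+-congʳ (-‿inverseʳ 1#)) ⟩
    a + (0# - b)             ≈⟨ +-congˡ (+-identityˡ _) ⟩
    a - b                    ∎

  ⟦⊖⟧ : ∀ m n → ⟦ m ⊖ n ⟧ ≈ m × 1# - n × 1#
  ⟦⊖⟧ m       zero    = sym (trans (+-congˡ ε⁻¹≈ε) (+-identityʳ _))
  ⟦⊖⟧ zero    (suc n) = sym (+-identityˡ _)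
  ⟦⊖⟧ (suc m) (suc n) = begin
    ⟦ suc m ⊖ suc n ⟧              ≈⟨ ⟦⟧-cong (ℤ.[1+m]⊖[1+n]≡m⊖n m n) ⟩
    ⟦ m ⊖ n ⟧                      ≈⟨ ⟦⊖⟧ m n ⟩
    m × 1# - n × 1#                ≈⟨ cancel-one _ _ ⟨
    (1# + m × 1#) - (1# + n × 1#)  ≈⟨ +-cong (1+× m 1#) (-‿cong (1+× n 1#)) ⟨
    suc m × 1# - suc n × 1#        ∎

  ⟦+⟧ : ∀ i j → ⟦ i ℤ.+ j ⟧ ≈ ⟦ i ⟧ + ⟦ j ⟧
  ⟦+⟧ (+ m)      (+ n)      = ×-homo-+ 1# m n
  ⟦+⟧ (+ m)      -[1+ n ]   = ⟦⊖⟧ m (suc n)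
  ⟦+⟧ -[1+ m ]   (+ n)      = trans (⟦⊖⟧ n (suc m)) (+-comm _ _)
  ⟦+⟧ -[1+ m ]   -[1+ n ]   = begin
    - (suc (suc (m ℕ.+ n)) × 1#)      ≈⟨ -‿cong (reflexive (≡.cong (_× 1#) (≡.sym (≡.cong suc (ℕ.+-suc m n))))) ⟩
    - ((suc m ℕ.+ suc n) × 1#)        ≈⟨ -‿cong (×-homo-+ 1# (suc m) (suc n)) ⟩
    - (suc m × 1# + suc n × 1#)       ≈⟨ ⁻¹-∙-comm _ _ ⟨
    - (suc m × 1#) + - (suc n × 1#)   ∎

  ⟦+*⟧ : ∀ m j → ⟦ (+ m) ℤ.* j ⟧ ≈ ⟦ + m ⟧ * ⟦ j ⟧
  ⟦+*⟧ m (+ n)    = trans (⟦⟧-cong (≡.sym (ℤ.pos-* m n))) (×1-homo-* m n)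
  ⟦+*⟧ m -[1+ n ] = begin
    ⟦ (+ m) ℤ.* -[1+ n ] ⟧           ≈⟨ ⟦⟧-cong (ℤ.neg-distribʳ-* (+ m) (+ suc n)) ⟨
    ⟦ ℤ.- ((+ m) ℤ.* (+ suc n)) ⟧    ≈⟨ ⟦-⟧ ((+ m) ℤ.* (+ suc n)) ⟩
    - ⟦ (+ m) ℤ.* (+ suc n) ⟧        ≈⟨ -‿cong (⟦+*⟧ m (+ suc n)) ⟩
    - (m × 1# * (suc n × 1#))        ≈⟨ -‿distribʳ-* _ _ ⟩
    m × 1# * - (suc n × 1#)          ∎

  ⟦*⟧ : ∀ i j → ⟦ i ℤ.* j ⟧ ≈ ⟦ i ⟧ * ⟦ j ⟧
  ⟦*⟧ (+ m)    j = ⟦+*⟧ m j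
  ⟦*⟧ -[1+ m ] j = begin
    ⟦ -[1+ m ] ℤ.* j ⟧           ≈⟨ ⟦⟧-cong (ℤ.neg-distribˡ-* (+ suc m) j) ⟨
    ⟦ ℤ.- ((+ suc m) ℤ.* j) ⟧    ≈⟨ ⟦-⟧ ((+ suc m) ℤ.* j) ⟩
    - ⟦ (+ suc m) ℤ.* j ⟧        ≈⟨ -‿cong (⟦+*⟧ (suc m) j) ⟩
    - (suc m × 1# * ⟦ j ⟧)       ≈⟨ -‿distribˡ-* _ _ ⟩
    - (suc m × 1#) * ⟦ j ⟧       ∎

  ℤ⟶R : CommutativeRing.rawRing ℤ.+-*-commutativeRing
          -Raw-AlmostCommutative⟶ fromCommutativeRing R
  ℤ⟶R = record
    { ⟦_⟧    = ⟦_⟧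
    ; +-homo = ⟦+⟧
    ; *-homo = ⟦*⟧
    ; -‿homo = ⟦-⟧
    ; 0-homo = refl
    ; 1-homo = refl
    }

  -- Normal forms need decidable coefficients, which ℤ has and `R` may lack. Distinct integers can
  -- still agree in `R`, so they give `nothing` rather than a refutation.
  coeff≟ : ∀ i j → Maybe (⟦ i ⟧ ≈ ⟦ j ⟧)
  coeff≟ i j with i ℤ.≟ j
  ... | yes i≡j = just (⟦⟧-cong i≡j)
  ... | no _    = nothing

-- Finite sums, diagonal sums and geometric series.

module FiniteSums (M : CommutativeMonoid 0ℓ 0ℓ) where

  open CommutativeMonoid M renaming (∙-cong to +-cong; ∙-congˡ to +-congˡ; ∙-congʳ to +-congʳ; _∙_ to _+_; ε to 0#)
  open import Algebra.Properties.CommutativeSemigroup commutativeSemigroup using (interchange)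

  Σ< : ℕ → (ℕ → Carrier) → Carrier
  Σ< zero    f = 0#
  Σ< (suc n) f = Σ< n f + f n

  Σ-cong< : ∀ n {f g} → (∀ i → i < n → f i ≈ g i) → Σ< n f ≈ Σ< n g
  Σ-cong< zero    f≈g = refl
  Σ-cong< (suc n) f≈g = +-cong (Σ-cong< n (λ i i<n → f≈g i (ℕ.m<n⇒m<1+n i<n))) (f≈g n (ℕ.n<1+n n))

  Σ-cong : ∀ n {f g} → (∀ i → f i ≈ g i) → Σ< n f ≈ Σ< n g
  Σ-cong n f≈g = Σ-cong< n (λ i _ → f≈g i)

  Σ-+ : ∀ n f g → Σ< n (λ i → f i + g i) ≈ Σ< n f + Σ< n g
  Σ-+ zero    f g = sym (identityˡ 0#)
  Σ-+ (suc n) f g = trans (+-congʳ (Σ-+ n f g)) (interchange _ _ _ _)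

  Σ-0 : ∀ n → Σ< n (λ _ → 0#) ≈ 0#
  Σ-0 zero    = refl
  Σ-0 (suc n) = trans (identityʳ _) (Σ-0 n)

  Σ-swap : ∀ m n (f : ℕ → ℕ → Carrier) → Σ< m (λ i → Σ< n (f i)) ≈ Σ< n (λ j → Σ< m (λ i → f i j))
  Σ-swap zero    n f = sym (Σ-0 n)
  Σ-swap (suc m) n f = trans (+-congʳ (Σ-swap m n f)) (sym (Σ-+ n _ _))

  Σ-front : ∀ n f → Σ< (suc n) f ≈ f 0 + Σ< n (λ i → f (suc i))
  Σ-front zero    f = comm 0# (f 0)
  Σ-front (suc n) f = trans (+-congʳ (Σ-front n f)) (assoc _ _ _)

  Σ-truncate : ∀ {m n} f → m ≤ n → (∀ i → m ≤ i → f i ≈ 0#) → Σ< n f ≈ Σ< m f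
  Σ-truncate {m} f m≤n f≈0 = go (ℕ.≤⇒≤′ m≤n)
    where
      go : ∀ {n} → m ≤′ n → Σ< n f ≈ Σ< m f
      go ≤′-refl        = refl
      go (≤′-step m≤′n) = trans (+-cong (go m≤′n) (f≈0 _ (ℕ.≤′⇒≤ m≤′n))) (identityʳ _)

  Σ-single : ∀ n k f → k < n → (∀ i → i ≢ k → f i ≈ 0#) → Σ< n f ≈ f k
  Σ-single (suc n) k f k<1+n f≈0 with n ℕ.≟ k
  ... | yes ≡.refl = trans (+-congʳ (trans (Σ-cong< n (λ i i<n → f≈0 i (ℕ.<⇒≢ i<n))) (Σ-0 n))) (identityˡ _)
  ... | no n≢k     = trans (+-cong (Σ-single n k f (ℕ.≤∧≢⇒< (ℕ.s≤s⁻¹ k<1+n) (λ k≡n → n≢k (≡.sym k≡n))) f≈0) (f≈0 n n≢k)) (identityʳ _)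

module Sums (R : CommutativeRing 0ℓ 0ℓ) where

  open CommutativeRing R public hiding (zero)
  open import Algebra.Properties.Semiring.Exp semiring public
  open FiniteSums +-commutativeMonoid public
  open import Relation.Binary.Reasoning.Setoid setoid public
  open IntegerCoefficients R using (ℤ⟶R; coeff≟)
  open RingSolver (CommutativeRing.rawRing ℤ.+-*-commutativeRing) (fromCommutativeRing R) ℤ⟶R coeff≟ public
    using (solve; _:=_; _:+_; _:*_; _:-_; :-_; con; Polynomial)

  :1 : ∀ {n} → Polynomial n
  :1 = con 1ℤ

  *-distribˡ-Σ : ∀ n a f → a * Σ< n f ≈ Σ< n (λ i → a * f i)
  *-distribˡ-Σ zero    a f = zeroʳ a
  *-distribˡ-Σ (suc n) a f = trans (distribˡ a _ _) (+-congʳ (*-distribˡ-Σ n a f))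

  ^-⊕ : ∀ x j r → x ^ (j ⊕ r) ≈ x ^ j * x ^ double r
  ^-⊕ x j zero    = sym (*-identityʳ _)
  ^-⊕ x j (suc r) = trans (*-congˡ (*-congˡ (^-⊕ x j r)))
    (solve 3 (λ x y z → x :* (x :* (y :* z)) := y :* (x :* (x :* z))) refl x (x ^ j) (x ^ double r))

  ^-double : ∀ x n → x ^ double n ≈ x ^ n * x ^ n
  ^-double x zero    = sym (*-identityʳ 1#)
  ^-double x (suc n) = trans (*-congˡ (*-congˡ (^-double x n)))
    (solve 2 (λ x y → x :* (x :* (y :* y)) := (x :* y) :* (x :* y)) refl x (x ^ n))

  swap-zero : ∀ {a b} c → a * b ≈ 0# → a * (b * c) ≈ 0#
  swap-zero c ab≈0 = trans (sym (*-assoc _ _ c)) (trans (*-congʳ ab≈0) (zeroˡ c))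

  Σ-telescope : ∀ (f g h : ℕ → Carrier) → (∀ i → f i + h i ≈ g i + h (suc i)) → ∀ n → Σ< n f + h 0 ≈ Σ< n g + h n
  Σ-telescope f g h step zero    = refl
  Σ-telescope f g h step (suc n) = begin
    Σ< n f + f n + h 0        ≈⟨ solve 3 (λ a b c → a :+ b :+ c := a :+ c :+ b) refl _ _ _ ⟩
    Σ< n f + h 0 + f n        ≈⟨ +-congʳ (Σ-telescope f g h step n) ⟩
    Σ< n g + h n + f n        ≈⟨ solve 3 (λ a b c → a :+ b :+ c := a :+ (c :+ b)) refl _ _ _ ⟩
    Σ< n g + (f n + h n)      ≈⟨ +-congˡ (step n) ⟩
    Σ< n g + (g n + h (suc n)) ≈⟨ +-assoc _ _ _ ⟨
    Σ< n g + g n + h (suc n)  ∎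

  -- The sum of X j r over all j + 2 r = n.
  D : ℕ → (ℕ → ℕ → Carrier) → Carrier
  D zero          X = X 0 0
  D (suc zero)    X = X 1 0
  D (suc (suc n)) X = X (suc (suc n)) 0 + D n (λ j r → X j (suc r))

  D-cong : ∀ n {X Y} → (∀ j r → X j r ≈ Y j r) → D n X ≈ D n Y
  D-cong zero          X≈Y = X≈Y 0 0
  D-cong (suc zero)    X≈Y = X≈Y 1 0
  D-cong (suc (suc n)) X≈Y = +-cong (X≈Y _ 0) (D-cong n (λ j r → X≈Y j (suc r)))

  D-+ : ∀ n X Y → D n (λ j r → X j r + Y j r) ≈ D n X + D n Y
  D-+ zero          X Y = refl
  D-+ (suc zero)    X Y = refl
  D-+ (suc (suc n)) X Y = trans (+-congˡ (D-+ n _ _))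
    (solve 4 (λ a b c d → (a :+ b) :+ (c :+ d) := (a :+ c) :+ (b :+ d)) refl _ _ _ _)

  D-* : ∀ n (b : ℕ → Carrier) X → D n (λ j r → b (j ⊕ r) * X j r) ≈ b n * D n X
  D-* zero          b X = refl
  D-* (suc zero)    b X = refl
  D-* (suc (suc n)) b X = trans (+-congˡ (D-* n (λ i → b (suc (suc i))) (λ j r → X j (suc r)))) (sym (distribˡ _ _ _))

  D-shiftˡ : ∀ n X → (∀ r → X 0 r ≈ 0#) → D (suc n) X ≈ D n (λ j r → X (suc j) r)
  D-shiftˡ zero          X X0≈0 = refl
  D-shiftˡ (suc zero)    X X0≈0 = trans (+-congˡ (X0≈0 1)) (+-identityʳ _)
  D-shiftˡ (suc (suc n)) X X0≈0 = +-congˡ (D-shiftˡ n (λ j r → X j (suc r)) (λ r → X0≈0 (suc r)))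

  Σ-D : ∀ n X → Σ< (suc (suc n)) (λ i → D i X) ≈ Σ< (suc (suc n)) (λ j → X j 0) + Σ< n (λ i → D i (λ j r → X j (suc r)))
  Σ-D zero    X = sym (+-identityʳ _)
  Σ-D (suc n) X = trans (+-congʳ (Σ-D n X))
    (solve 4 (λ a b c d → (a :+ b) :+ (c :+ d) := (a :+ c) :+ (b :+ d)) refl _ _ _ _)

  -- The diagonals n ≤ 2k fill the triangle j + 2r < 2k + 1, which is resummed by columns. As the
  -- bound is odd, r = 0, ..., k are exactly the nonempty columns, of lengths 2k + 1, ..., 3, 1.
  Σ-D-exchange : ∀ k X Y → (∀ r J → J ⊕ r ≡ suc (double k) → Σ< J (λ j → X j r) ≈ Y r) →
                 Σ< (suc (double k)) (λ n → D n X) ≈ Σ< (suc k) Y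
  Σ-D-exchange zero    X Y col = trans (col 0 1 ≡.refl) (sym (+-identityˡ _))
  Σ-D-exchange (suc k) X Y col = begin
    Σ< (suc (double (suc k))) (λ n → D n X)
      ≈⟨ Σ-D (suc (double k)) X ⟩
    Σ< (suc (double (suc k))) (λ j → X j 0) + Σ< (suc (double k)) (λ n → D n (λ j r → X j (suc r)))
      ≈⟨ +-cong (col 0 _ ≡.refl) (Σ-D-exchange k _ _ (λ r J eq → col (suc r) J (≡.cong (λ n → suc (suc n)) eq))) ⟩
    Y 0 + Σ< (suc k) (λ r → Y (suc r))
      ≈⟨ Σ-front (suc k) Y ⟨
    Σ< (suc (suc k)) Y ∎

  *-^-double : ∀ x n → (x * x) ^ n ≈ x ^ double n
  *-^-double x zero    = refl
  *-^-double x (suc n) = trans (*-congˡ (*-^-double x n)) (*-assoc x x _)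

  geometric : ∀ x n → (1# - x) * Σ< n (x ^_) ≈ 1# - x ^ n
  geometric x zero    = trans (zeroʳ _) (sym (-‿inverseʳ 1#))
  geometric x (suc n) = begin
    (1# - x) * (Σ< n (x ^_) + x ^ n)               ≈⟨ distribˡ _ _ _ ⟩
    (1# - x) * Σ< n (x ^_) + (1# - x) * x ^ n      ≈⟨ +-congʳ (geometric x n) ⟩
    (1# - x ^ n) + (1# - x) * x ^ n                ≈⟨ solve 2 (λ x y → (:1 :- y) :+ (:1 :- x) :* y := :1 :- x :* y) refl x (x ^ n) ⟩
    1# - x ^ suc n                                 ∎

  module Nilpotent (q : Carrier) (N : ℕ) (q^1+N≈0 : q ^ suc N ≈ 0#) where

    ^-vanishes : ∀ k → N < k → q ^ k ≈ 0#
    ^-vanishes k N<k = begin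
      q ^ k                              ≈⟨ ^-congʳ q (ℕ.m+[n∸m]≡n N<k) ⟨
      q ^ (suc N ℕ.+ (k ℕ.∸ suc N))      ≈⟨ ^-homo-* q (suc N) _ ⟩
      q ^ suc N * q ^ (k ℕ.∸ suc N)      ≈⟨ trans (*-congʳ q^1+N≈0) (zeroˡ _) ⟩
      0#                                 ∎

    -- The geometric series of 1/(1 - q^k); for k ≥ 1 the first omitted power already vanishes.
    inverse : ℕ → Carrier
    inverse k = Σ< (suc N) ((q ^ k) ^_)

    inverse-correct : ∀ k → (1# - q ^ suc k) * inverse (suc k) ≈ 1#
    inverse-correct k = begin
      (1# - q ^ suc k) * inverse (suc k)  ≈⟨ geometric (q ^ suc k) (suc N) ⟩
      1# - (q ^ suc k) ^ suc N            ≈⟨ +-congˡ (-‿cong (trans (^-assocʳ q (suc k) (suc N)) (^-vanishes _ (ℕ.m≤m+n (suc N) _)))) ⟩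
      1# - 0#                             ≈⟨ solve 0 (:1 :- con 0ℤ := :1) refl ⟩
      1#                                  ∎

-- The q-series identity.

module QSeries (R : CommutativeRing 0ℓ 0ℓ) where

  open Sums R

  -- The q-Zeilberger certificate for g below, with A = q^(2ρ+2) and x = q^j.
  certificate : Carrier → Carrier → Carrier → Carrier
  certificate q A x = A * (A + A * x + A * q * x - (1# + 1#) - A * A * A * q * x * x)

  -- This is `g-suc` divided by `g ρ j` and cleared of the two odd factors 1 - q^(2n+5) and 1 -
  -- q^(2n+7), n = j + 2ρ, in which `O` differs between g(ρ+1) and g(ρ). With `A` and `x`
  -- independent of `q` it is a polynomial identity, so normalisation decides it.
  certificate-identity : ∀ q A x →
    (1# - A * x) * (1# - A * x) * ((1# - A * x * q) * (1# - A * x * q)) ≈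
    (1# - A) * (1# - A) * ((1# - A * x * (A * x) * q) * (1# - A * x * (A * x) * q * (q * q)))
    + (x * q * ((1# - A * x) * (1# - A * x)) * certificate q A (x * q)
       - (1# - x) * certificate q A x * (1# - A * x * (A * x) * q * (q * q)))
  certificate-identity = solve 3 (λ q A x →
    let cert : _ → _
        cert x = A :* (A :+ A :* x :+ A :* q :* x :- (:1 :+ :1) :- A :* A :* A :* q :* x :* x) in
    (:1 :- A :* x) :* (:1 :- A :* x) :* ((:1 :- A :* x :* q) :* (:1 :- A :* x :* q)) :=
    (:1 :- A) :* (:1 :- A) :* ((:1 :- A :* x :* (A :* x) :* q) :* (:1 :- A :* x :* (A :* x) :* q :* (q :* q)))
    :+ (x :* q :* ((:1 :- A :* x) :* (:1 :- A :* x)) :* cert (x :* q)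
       :- (:1 :- x) :* cert x :* (:1 :- A :* x :* (A :* x) :* q :* (q :* q)))) refl

  -- The way back from `certificate-identity` (the hypothesis `core`) to quotients. The factors of
  -- `g` and `h` are opaque letters, tied only by the inverses `v`, `w`, `k` of `α`, `β`, `z`; the
  -- solver never has to expand powers of q.
  telescoping-step : ∀ P t U O a b e α β y z xq p p′ v w k →
    a * a * (b * b) ≈ e * e * (α * β) + (xq * (a * a) * p′ - y * p * β) →
    α * v ≈ 1# → β * w ≈ 1# → z * k ≈ 1# →
    (P * a * b) * (P * a * b) * t * U * (O * v * w) + P * P * t * U * O * (y * p * v)
    ≈ e * e * (P * P * t * U * O) + (P * a) * (P * a) * (t * xq) * (U * k) * (O * v) * (z * p′ * w)
  telescoping-step P t U O a b e α β y z xq p p′ v w k core αv βw zk = begin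
    (P * a * b) * (P * a * b) * t * U * (O * v * w) + c * (y * p * v)
      ≈⟨ +-cong (solve 8 (λ P t U O a b v w → (P :* a :* b) :* (P :* a :* b) :* t :* U :* (O :* v :* w)
                 := P :* P :* t :* U :* O :* (v :* w) :* (a :* a :* (b :* b))) refl P t U O a b v w)
                -- Inserting `β * w`, which is 1, gives both terms the common denominator `v * w`.
                (trans (sym (*-identityʳ _)) (*-congˡ (sym βw))) ⟩
    c * (v * w) * (a * a * (b * b)) + c * (y * p * v) * (β * w)
      ≈⟨ +-congʳ (*-congˡ core) ⟩
    c * (v * w) * (e * e * (α * β) + (xq * (a * a) * p′ - y * p * β)) + c * (y * p * v) * (β * w)
      ≈⟨ solve 11 (λ c v w e α β x a p′ y p →
            c :* (v :* w) :* (e :* e :* (α :* β) :+ (x :* (a :* a) :* p′ :- y :* p :* β)) :+ c :* (y :* p :* v) :* (β :* w)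
         := e :* e :* (c :* (α :* v) :* (β :* w)) :+ c :* (v :* w) :* (x :* (a :* a) :* p′)) refl c v w e α β xq a p′ y p ⟩
    e * e * (c * (α * v) * (β * w)) + c * (v * w) * (xq * (a * a) * p′)
      ≈⟨ +-cong (*-congˡ (trans (*-cong (trans (*-congˡ αv) (*-identityʳ _)) βw) (*-identityʳ _)))
                (trans (sym (*-identityʳ _)) (*-congˡ (sym zk))) ⟩
    e * e * c + c * (v * w) * (xq * (a * a) * p′) * (z * k)
      ≈⟨ +-congˡ (solve 11 (λ P t U O v w x a p′ z k →
           P :* P :* t :* U :* O :* (v :* w) :* (x :* (a :* a) :* p′) :* (z :* k)
           := (P :* a) :* (P :* a) :* (t :* x) :* (U :* k) :* (O :* v) :* (z :* p′ :* w)) refl P t U O v w xq a p′ z k) ⟩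
    _ ∎
    where c = P * P * t * U * O

  module Products (q : Carrier) (u : ℕ → Carrier) (u-inverse : ∀ k → (1# - q ^ suc k) * u (suc k) ≈ 1#) where

    φ : ℕ → Carrier
    φ k = 1# - q ^ k

    -- P = (q;q)ₙ, U = 1/(q;q)ₙ, O = 1/(q;q²)ₙ, V = 1/(q²;q²)ₙ, Q = (q²;q²)ₙ, where u k = 1/(1 - q^k).
    P U O V Q : ℕ → Carrier
    P zero    = 1#
    P (suc n) = P n * φ (suc n)
    U zero    = 1#
    U (suc n) = U n * u (suc n)
    O zero    = 1#
    O (suc n) = O n * u (suc (double n))
    V zero    = 1#
    V (suc n) = V n * u (double (suc n))
    Q zero    = 1#
    Q (suc n) = Q n * φ (double (suc n))

    unpair : ∀ a b x y → x * y ≈ 1# → a * b ≈ 1# → a * x * (b * y) ≈ 1#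
    unpair a b x y xy ab = trans (solve 4 (λ a b x y → a :* x :* (b :* y) := (a :* b) :* (x :* y)) refl a b x y)
      (trans (*-cong ab xy) (*-identityʳ 1#))

    PU≈1 : ∀ n → P n * U n ≈ 1#
    PU≈1 zero    = *-identityʳ 1#
    PU≈1 (suc n) = unpair _ _ _ _ (u-inverse n) (PU≈1 n)

    QV≈1 : ∀ n → Q n * V n ≈ 1#
    QV≈1 zero    = *-identityʳ 1#
    QV≈1 (suc n) = unpair _ _ _ _ (u-inverse (suc (double n))) (QV≈1 n)

    U-double : ∀ n → U (double n) ≈ O n * V n
    U-double zero    = sym (*-identityʳ 1#)
    U-double (suc n) = trans (*-congʳ (*-congʳ (U-double n)))
      (solve 4 (λ a b c d → a :* b :* c :* d := a :* c :* (b :* d)) refl _ _ _ _)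

    -- t j = q^(j (j + 1) / 2).
    t : ℕ → Carrier
    t zero    = 1#
    t (suc j) = t j * q ^ suc j

    -- The index `n` stays separate from `j` because `suc j ⊕ ρ` equals `suc (j ⊕ ρ)` only
    -- propositionally; `G-cong` transports along that equation.
    G : ℕ → ℕ → Carrier
    G n j = P (suc n) * P (suc n) * t j * U j * O (suc (suc n))

    -- The summand of the sum over j for r = ρ + 1; this shift keeps the index 2r + j - 1 free of
    -- truncated subtraction.
    g : ℕ → ℕ → Carrier
    g ρ j = G (j ⊕ ρ) j

    -- The remainder after j terms in the case r = 1, that is q^(j(j+1)/2) (q)_{j+1} / (q;q²)_{j+1}.
    rest : ℕ → Carrier
    rest j = t j * P (suc j) * O (suc j)

    q^odd : ∀ n → q ^ suc (double n) ≈ q ^ n * q ^ n * q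
    q^odd n = trans (*-congˡ (^-double q n)) (*-comm q _)

    odd-inverse : ∀ n → (1# - q ^ n * q ^ n * q) * u (suc (double n)) ≈ 1#
    odd-inverse n = trans (*-congʳ (+-congˡ (-‿cong (sym (q^odd n))))) (u-inverse (double n))

    -- Without the common factors this reads (1 - y) + y (1 - y q) = 1 - y² q with y = q^(j+1), and
    -- the right side cancels the newest factor of `O`.
    g-zero : ∀ j → g 0 j + rest (suc j) ≈ rest j
    g-zero j = begin
      p * f * (p * f) * t j * U j * (o * w) + t j * y * (p * f * φ′) * (o * w)
        ≈⟨ +-cong (solve 6 (λ p f t U o w → p :* f :* (p :* f) :* t :* U :* (o :* w) := (p :* U) :* (p :* f :* t :* o) :* (f :* w)) refl p f (t j) (U j) o w) refl ⟩
      (p * U j) * (p * f * t j * o) * (f * w) + t j * y * (p * f * φ′) * (o * w)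
        ≈⟨ +-congʳ (*-congʳ (trans (*-congʳ (PU≈1 j)) (*-identityˡ _))) ⟩
      (p * f * t j * o) * (f * w) + t j * y * (p * f * φ′) * (o * w)
        ≈⟨ +-congˡ (*-congʳ (*-congˡ (*-congˡ (+-congˡ (-‿cong (*-comm q y)))))) ⟩
      (p * f * t j * o) * ((1# - y) * w) + t j * y * (p * f * (1# - y * q)) * (o * w)
        ≈⟨ solve 7 (λ p f t o y w q → (p :* f :* t :* o) :* ((:1 :- y) :* w) :+ t :* y :* (p :* f :* (:1 :- y :* q)) :* (o :* w)
                    := t :* (p :* f) :* o :* ((:1 :- y :* y :* q) :* w)) refl p f (t j) o y w q ⟩
      t j * (p * f) * o * ((1# - y * y * q) * w)
        ≈⟨ trans (*-congˡ (odd-inverse (suc j))) (*-identityʳ _) ⟩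
      rest j ∎
      where
        p = P j
        f = φ (suc j)
        φ′ = φ (suc (suc j))
        o = O (suc j)
        w = u (suc (double (suc j)))
        y = q ^ suc j

    -- The telescoping partner of `g`: its factor 1 - x vanishes at j = 0, so there is no lower
    -- boundary term, and the factor `t j` inside `G` makes the upper one divisible by q^j.
    h : ℕ → ℕ → Carrier
    h ρ j = G (j ⊕ ρ) j * ((1# - x) * certificate q A x * u (suc (double (j ⊕ suc ρ))))
      where
        A = q ^ double (suc ρ)
        x = q ^ j

    G-cong : ∀ {m n} j → m ≡ n → G m j ≈ G n j
    G-cong j ≡.refl = refl

    certificate-cong : ∀ A {x y} → x ≈ y → certificate q A x ≈ certificate q A y
    certificate-cong A x≈y = *-congˡ (+-cong (+-cong (+-cong (+-congˡ (*-congˡ x≈y)) (*-congˡ x≈y)) refl) (-‿cong (*-cong (*-congˡ x≈y) x≈y)))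

    -- Summed over j, this multiplies the sum by (1 - q^(2ρ+2))², which is also the factor by which
    -- the square of `Q` grows.
    g-suc : ∀ ρ j → g (suc ρ) j + h ρ j ≈ φ (double (suc ρ)) * φ (double (suc ρ)) * g ρ j + h ρ (suc j)
    g-suc ρ j = begin
      g (suc ρ) j + h ρ j
        ≈⟨ +-congʳ (*-congʳ (*-congʳ (*-congʳ (*-cong Pshift Pshift)))) ⟩
      (P₁ * a * b) * (P₁ * a * b) * t j * U j * (O₂ * v * w) + h ρ j
        ≈⟨ telescoping-step P₁ (t j) (U j) O₂ a b (1# - A) α β (1# - x) (1# - x * q) (x * q) p p′ v w (u (suc j))
             (certificate-identity q A x) αv βw zk ⟩
      (1# - A) * (1# - A) * g ρ j
        + (P₁ * a) * (P₁ * a) * (t j * (x * q)) * (U j * u (suc j)) * (O₂ * v) * ((1# - x * q) * p′ * w)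
        ≈⟨ +-congˡ (*-cong (*-congʳ (*-congʳ (*-cong (*-cong Pa Pa) (*-congˡ (*-comm x q))))) (*-congʳ (*-cong (+-congˡ (-‿cong (*-comm x q))) (certificate-cong A (*-comm x q))))) ⟩
      (1# - A) * (1# - A) * g ρ j + G (suc (j ⊕ ρ)) (suc j) * ((1# - q * x) * certificate q A (q * x) * w)
        ≈⟨ +-congˡ (*-cong (G-cong (suc j) (≡.sym (suc-⊕ j ρ))) (*-congˡ (reflexive (≡.cong (λ n → u (suc (double n))) (≡.sym (suc-⊕ j (suc ρ))))))) ⟩
      φ (double (suc ρ)) * φ (double (suc ρ)) * g ρ j + h ρ (suc j) ∎
      where
        A = q ^ double (suc ρ)
        x = q ^ j
        n = j ⊕ ρ
        P₁ = P (suc n)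
        O₂ = O (suc (suc n))
        a = 1# - A * x
        b = 1# - A * x * q
        α = 1# - A * x * (A * x) * q
        β = 1# - A * x * (A * x) * q * (q * q)
        v = u (suc (double (suc (suc n))))
        w = u (suc (double (suc (suc (suc n)))))
        p = certificate q A x
        p′ = certificate q A (x * q)

        q^n+2 : q ^ suc (suc n) ≈ A * x
        q^n+2 = trans (^-⊕ q j (suc ρ)) (*-comm x A)

        q^n+3 : q ^ suc (suc (suc n)) ≈ A * x * q
        q^n+3 = trans (*-congˡ q^n+2) (*-comm q _)

        αv : α * v ≈ 1#
        αv = trans (*-congʳ (+-congˡ (-‿cong (*-congʳ (sym (*-cong q^n+2 q^n+2)))))) (odd-inverse (suc (suc n)))

        βw : β * w ≈ 1#
        βw = trans (*-congʳ (+-congˡ (-‿cong (trans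
               (solve 2 (λ y q → y :* y :* q :* (q :* q) := y :* q :* (y :* q) :* q) refl (A * x) q)
               (*-congʳ (sym (*-cong q^n+3 q^n+3))))))) (odd-inverse (suc (suc (suc n))))

        zk : (1# - x * q) * u (suc j) ≈ 1#
        zk = trans (*-congʳ (+-congˡ (-‿cong (*-comm x q)))) (u-inverse j)

        Pshift : P (suc (suc (suc n))) ≈ P₁ * a * b
        Pshift = *-cong (*-congˡ (+-congˡ (-‿cong q^n+2))) (+-congˡ (-‿cong q^n+3))

        Pa : P₁ * a ≈ P (suc (suc n))
        Pa = *-congˡ (+-congˡ (-‿cong (sym q^n+2)))

    -- q^J is the last factor of `t J`. Together with `swap-zero` this is the source of all
    -- divisibility of the remainders.
    t-vanishes : ∀ {a} J → a * q ^ J ≈ 0# → a * t J ≈ 0#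
    t-vanishes zero    aq≈0 = aq≈0
    t-vanishes (suc J) aq≈0 = trans (*-congˡ (*-comm _ _)) (swap-zero _ aq≈0)

    rest-vanishes : ∀ {a} J → a * q ^ J ≈ 0# → a * rest J ≈ 0#
    rest-vanishes J aq≈0 = trans (*-congˡ (*-assoc _ _ _)) (swap-zero _ (t-vanishes J aq≈0))

    h-vanishes : ∀ {a} ρ J → a * q ^ J ≈ 0# → a * h ρ J ≈ 0#
    h-vanishes ρ J aq≈0 = trans
      (*-congˡ (solve 5 (λ p t U O c → p :* p :* t :* U :* O :* c := t :* (p :* p :* U :* O :* c)) refl _ _ _ _ _))
      (swap-zero _ (t-vanishes J aq≈0))

    φ0≈0 : φ 0 ≈ 0#
    φ0≈0 = -‿inverseʳ 1#

    h-zero : ∀ ρ → h ρ 0 ≈ 0#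
    h-zero ρ = trans (*-congˡ (trans (*-congʳ (trans (*-congʳ φ0≈0) (zeroˡ _))) (zeroˡ _))) (zeroʳ _)

    -- For infinite J the sum is Q ρ ² exactly; the factor a with a q^J = 0 annihilates the tail.
    Σ-g : ∀ ρ J a → a * q ^ J ≈ 0# → a * Σ< J (g ρ) ≈ a * (Q ρ * Q ρ)
    Σ-g zero J a aq≈0 = begin
      a * Σ< J (g 0)                      ≈⟨ +-identityʳ _ ⟨
      a * Σ< J (g 0) + 0#                 ≈⟨ +-congˡ (rest-vanishes J aq≈0) ⟨
      a * Σ< J (g 0) + a * rest J         ≈⟨ distribˡ a _ _ ⟨
      a * (Σ< J (g 0) + rest J)           ≈⟨ *-congˡ (Σ-telescope (λ _ → 0#) (g 0) rest (λ j → trans (+-identityˡ _) (sym (g-zero j))) J) ⟨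
      a * (Σ< J (λ _ → 0#) + rest 0)      ≈⟨ *-congˡ (trans (+-congʳ (Σ-0 J)) (+-identityˡ _)) ⟩
      -- `O 1` and `U 1` are the same term, both 1/(1 - q).
      a * rest 0                          ≈⟨ *-congˡ (trans (*-congʳ (*-identityˡ _)) (trans (PU≈1 1) (sym (*-identityʳ 1#)))) ⟩
      a * (1# * 1#)                       ∎
    Σ-g (suc ρ) J a aq≈0 = begin
      a * Σ< J (g (suc ρ))                ≈⟨ *-congˡ (+-identityʳ _) ⟨
      a * (Σ< J (g (suc ρ)) + 0#)         ≈⟨ *-congˡ (+-congˡ (h-zero ρ)) ⟨
      a * (Σ< J (g (suc ρ)) + h ρ 0)      ≈⟨ *-congˡ (Σ-telescope _ (λ j → e * e * g ρ j) (h ρ) (g-suc ρ) J) ⟩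
      a * (Σ< J (λ j → e * e * g ρ j) + h ρ J)  ≈⟨ distribˡ a _ _ ⟩
      a * Σ< J (λ j → e * e * g ρ j) + a * h ρ J  ≈⟨ +-cong (*-congˡ (sym (*-distribˡ-Σ J _ _))) (h-vanishes ρ J aq≈0) ⟩
      a * (e * e * Σ< J (g ρ)) + 0#       ≈⟨ solve 3 (λ a e s → a :* (e :* e :* s) :+ con 0ℤ := e :* e :* (a :* s)) refl a e _ ⟩
      e * e * (a * Σ< J (g ρ))            ≈⟨ *-congˡ (Σ-g ρ J a aq≈0) ⟩
      e * e * (a * (Q ρ * Q ρ))           ≈⟨ solve 3 (λ a e s → e :* e :* (a :* (s :* s)) := a :* (s :* e :* (s :* e))) refl a e _ ⟩
      a * (Q (suc ρ) * Q (suc ρ))         ∎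
      where e = φ (double (suc ρ))

    E : ℕ → ℕ → Carrier
    E j r = q ^ triangular j * U j * V r

    F : ℕ → ℕ → Carrier
    F j r = q ^ j * E j r

    φ-E : ∀ j r → φ (suc j) * E (suc j) r ≈ F j r
    φ-E j r = begin
      φ (suc j) * (q ^ triangular (suc j) * (U j * u (suc j)) * V r)
        ≈⟨ *-congˡ (*-congʳ (*-congʳ (^-homo-* q (triangular j) j))) ⟩
      φ (suc j) * (q ^ triangular j * q ^ j * (U j * u (suc j)) * V r)
        ≈⟨ solve 6 (λ f x y U w V → f :* (x :* y :* (U :* w) :* V) := f :* w :* (y :* (x :* U :* V))) refl _ _ _ _ _ _ ⟩
      φ (suc j) * u (suc j) * F j r
        ≈⟨ trans (*-congʳ (u-inverse j)) (*-identityˡ _) ⟩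
      F j r ∎

    D-φ-E : ∀ n → D (suc n) (λ j r → φ j * E j r) ≈ D n F
    D-φ-E n = trans (D-shiftˡ n _ (λ r → trans (*-congʳ φ0≈0) (zeroˡ _))) (D-cong n φ-E)

    -- Split 1 - q^(j+2r) = (1 - q^j) + q^j (1 - q^(2r)). The first part cancels a factor of `U` and
    -- lowers j by 1; the second cancels a factor of `V` and lowers r by 1, hence the diagonal by 2.
    φ-D-E : ∀ n → φ (suc n) * D (suc n) E ≈ D n E
    φ-D-E zero = trans (φ-E 0 0) (*-identityˡ _)
    φ-D-E (suc n) = begin
      φ (suc (suc n)) * D (suc (suc n)) E
        ≈⟨ D-* (suc (suc n)) φ E ⟨
      D (suc (suc n)) (λ j r → φ (j ⊕ r) * E j r)
        ≈⟨ D-cong (suc (suc n)) split ⟩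
      D (suc (suc n)) (λ j r → φ j * E j r + q ^ j * (φ (double r) * E j r))
        ≈⟨ D-+ (suc (suc n)) (λ j r → φ j * E j r) (λ j r → q ^ j * (φ (double r) * E j r)) ⟩
      D (suc (suc n)) (λ j r → φ j * E j r) + D (suc (suc n)) (λ j r → q ^ j * (φ (double r) * E j r))
        ≈⟨ +-cong (D-φ-E (suc n)) (trans (+-congʳ (trans (*-congˡ (trans (*-congʳ φ0≈0) (zeroˡ _))) (zeroʳ _))) (+-identityˡ _)) ⟩
      D (suc n) F + D n (λ j r → q ^ j * (φ (double (suc r)) * E j (suc r)))
        ≈⟨ +-congˡ (D-cong n (λ j r → *-congˡ (trans
             (solve 4 (λ f x V w → f :* (x :* (V :* w)) := f :* w :* (x :* V)) refl _ _ _ _)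
             (trans (*-congʳ (u-inverse (suc (double r)))) (*-identityˡ _))))) ⟩
      D (suc n) F + D n F
        -- The shift in j, read backwards, lifts the second sum to the diagonal of the first, where
        -- q^j + (1 - q^j) = 1 recombines them.
        ≈⟨ +-congˡ (D-φ-E n) ⟨
      D (suc n) F + D (suc n) (λ j r → φ j * E j r)
        ≈⟨ D-+ (suc n) _ _ ⟨
      D (suc n) (λ j r → F j r + φ j * E j r)
        ≈⟨ D-cong (suc n) (λ j r → solve 2 (λ x e → x :* e :+ (:1 :- x) :* e := e) refl _ _) ⟩
      D (suc n) E ∎
      where
        split : ∀ j r → φ (j ⊕ r) * E j r ≈ φ j * E j r + q ^ j * (φ (double r) * E j r)
        split j r = trans (*-congʳ (+-congˡ (-‿cong (^-⊕ q j r))))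
          (solve 3 (λ x y e → (:1 :- x :* y) :* e := (:1 :- x) :* e :+ x :* ((:1 :- y) :* e)) refl _ _ _)

    -- The coefficient of z^n in 1/(z;q)∞ = (-z;q)∞ / (z²;q²)∞, each product expanded by Euler's
    -- theorem. Both sides satisfy the same first-order recurrence in n.
    euler : ∀ n → U n ≈ D n E
    euler zero    = trans (sym (*-identityʳ 1#)) (sym (*-identityʳ _))
    euler (suc n) = begin
      U n * u (suc n)                             ≈⟨ *-congʳ (trans (euler n) (sym (φ-D-E n))) ⟩
      φ (suc n) * D (suc n) E * u (suc n)         ≈⟨ solve 3 (λ f d w → f :* d :* w := f :* w :* d) refl _ _ _ ⟩
      φ (suc n) * u (suc n) * D (suc n) E         ≈⟨ trans (*-congʳ (u-inverse n)) (*-identityˡ _) ⟩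
      D (suc n) E                                 ∎

    -- The contribution of smallest part n without its factor `U n`, which is split off for `euler`
    -- to expand. The value 0 at n = 0 lets the diagonal n = 0 be included at no cost.
    B : ℕ → Carrier
    B zero    = 0#
    B (suc n) = q ^ suc n * (P n * P n) * O (suc n)

    T : ℕ → Carrier
    T ρ = q ^ double (suc ρ) * V (suc ρ) * (Q ρ * Q ρ)

    B-E : ∀ ρ j → B (j ⊕ suc ρ) * E j (suc ρ) ≈ q ^ double (suc ρ) * V (suc ρ) * g ρ j
    B-E ρ j = begin
      q ^ (j ⊕ suc ρ) * (p * p) * o * (q ^ triangular j * U j * V (suc ρ))
        ≈⟨ *-congʳ (*-congʳ (*-congʳ (^-⊕ q j (suc ρ)))) ⟩
      q ^ j * q ^ double (suc ρ) * (p * p) * o * (q ^ triangular j * U j * V (suc ρ))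
        ≈⟨ solve 7 (λ x y p o z U V → x :* y :* (p :* p) :* o :* (z :* U :* V) := y :* V :* (p :* p :* (z :* x) :* U :* o)) refl _ _ p o _ _ _ ⟩
      q ^ double (suc ρ) * V (suc ρ) * (p * p * (q ^ triangular j * q ^ j) * U j * o)
        ≈⟨ *-congˡ (*-congʳ (*-congʳ (*-congˡ (t-triangular j)))) ⟩
      q ^ double (suc ρ) * V (suc ρ) * g ρ j ∎
      where
        p = P (suc (j ⊕ ρ))
        o = O (j ⊕ suc ρ)
        t-triangular : ∀ j → q ^ triangular j * q ^ j ≈ t j
        t-triangular zero    = *-identityʳ 1#
        t-triangular (suc j) = *-congʳ (trans (^-homo-* q (triangular j) j) (t-triangular j))

    spt-identity : ∀ k → q ^ suc (double k) ≈ 0# →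
      Σ< (double k) (λ ν → B (suc ν) * U (suc ν) * φ (triangular (suc ν))) ≈ Σ< k T
    spt-identity k q^≈0 = begin
      Σ< (double k) (λ ν → a (suc ν) * φ (triangular (suc ν)))
        ≈⟨ trans (Σ-front (double k) (λ n → a n * φ (triangular n))) (trans (+-congʳ (trans (*-congˡ φ0≈0) (zeroʳ _))) (+-identityˡ _)) ⟨
      Σ< K (λ n → a n * φ (triangular n))
        ≈⟨ Σ-cong K (λ n → solve 2 (λ a x → a :* (:1 :- x) := a :+ :- (a :* x)) refl _ _) ⟩
      Σ< K (λ n → a n + - (a n * q ^ triangular n))
        ≈⟨ Σ-+ K _ _ ⟩
      Σ< K a + Σ< K (λ n → - (a n * q ^ triangular n))
        ≈⟨ +-cong total (Σ-cong K (λ n → -‿cong (solve 3 (λ b U x → b :* U :* x := b :* (x :* U :* :1)) refl _ _ _))) ⟩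
      (Σ< K (λ j → X j 0) + Σ< k T) + Σ< K (λ n → - X n 0)
        ≈⟨ solve 3 (λ x y z → (x :+ y) :+ z := y :+ (x :+ z)) refl _ _ _ ⟩
      Σ< k T + (Σ< K (λ j → X j 0) + Σ< K (λ n → - X n 0))
        ≈⟨ +-congˡ (trans (sym (Σ-+ K _ _)) (trans (Σ-cong K (λ n → -‿inverseʳ _)) (Σ-0 K))) ⟩
      Σ< k T + 0#
        ≈⟨ +-identityʳ _ ⟩
      Σ< k T ∎
      where
        K = suc (double k)
        a : ℕ → Carrier
        a n = B n * U n
        X : ℕ → ℕ → Carrier
        X j r = B (j ⊕ r) * E j r
        Y : ℕ → Carrier
        Y zero    = Σ< K (λ j → X j 0)
        Y (suc ρ) = T ρ

        column : ∀ r J → J ⊕ r ≡ K → Σ< J (λ j → X j r) ≈ Y r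
        column zero    J ≡.refl = refl
        column (suc ρ) J eq     = begin
          Σ< J (λ j → X j (suc ρ))  ≈⟨ Σ-cong J (B-E ρ) ⟩
          Σ< J (λ j → c * g ρ j)    ≈⟨ *-distribˡ-Σ J c (g ρ) ⟨
          c * Σ< J (g ρ)            ≈⟨ Σ-g ρ J c c-vanishes ⟩
          T ρ                       ∎
          where
            c = q ^ double (suc ρ) * V (suc ρ)
            -- Column r = ρ + 1 ends where J + 2r = 2k + 1, so the prefactor q^(2r) supplies exactly
            -- the powers that q^J lacks to vanish. Hence the finite column already has the value of
            -- the infinite sum.
            c-vanishes : c * q ^ J ≈ 0#
            c-vanishes = begin
              q ^ double (suc ρ) * V (suc ρ) * q ^ J    ≈⟨ solve 3 (λ x V y → x :* V :* y := V :* (y :* x)) refl _ _ _ ⟩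
              V (suc ρ) * (q ^ J * q ^ double (suc ρ))  ≈⟨ *-congˡ (^-⊕ q J (suc ρ)) ⟨
              V (suc ρ) * q ^ (J ⊕ suc ρ)               ≈⟨ *-congˡ (trans (^-congʳ q eq) q^≈0) ⟩
              V (suc ρ) * 0#                            ≈⟨ zeroʳ _ ⟩
              0#                                        ∎

        total : Σ< K a ≈ Σ< K (λ j → X j 0) + Σ< k T
        total = begin
          Σ< K a                                  ≈⟨ Σ-cong K (λ n → trans (*-congˡ (euler n)) (sym (D-* n B E))) ⟩
          Σ< K (λ n → D n X)                      ≈⟨ Σ-D-exchange k X Y column ⟩
          Σ< (suc k) Y                            ≈⟨ Σ-front k Y ⟩
          Σ< K (λ j → X j 0) + Σ< k T             ∎

-- Generating functions of nonincreasing lists with marked parts.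

module Layers (R : CommutativeRing 0ℓ 0ℓ) where
  open Sums R

  ⌊_⌋ : Bool → Carrier
  ⌊ b ⌋ = if b then 1# else 0#

  module _ (y : Carrier) (allowed : ℕ → Bool) where

    -- Generating function of the nonincreasing lists of length L with allowed parts in 1, …, b,
    -- weighted additively: a part x on top of a list of length L contributes source L x.
    layer : (source : ℕ → ℕ → Carrier) (c : Carrier) → ℕ → ℕ → Carrier
    layer source c zero    b = c
    layer source c (suc L) b = Σ< b λ i → ⌊ allowed (suc i) ⌋ * (y ^ suc i * (layer source c L (suc i) + source L (suc i)))

    -- Divisibility of `f L b` by y^L, put in terms of annihilators: each of the L parts contributes
    -- at least one factor `y`.
    Vanishing : (ℕ → ℕ → Carrier) → Set
    Vanishing f = ∀ L b a → a * y ^ L ≈ 0# → a * f L b ≈ 0#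

    layer-vanishing : ∀ source c → Vanishing source → Vanishing (layer source c)
    layer-vanishing source c src zero    b a ay≈0 = trans (*-congʳ (trans (sym (*-identityʳ a)) ay≈0)) (zeroˡ c)
    layer-vanishing source c src (suc L) b a ay≈0 = begin
      a * Σ< b (λ i → ⌊ allowed (suc i) ⌋ * (y ^ suc i * (layer source c L (suc i) + source L (suc i))))
        ≈⟨ *-distribˡ-Σ b a _ ⟩
      Σ< b (λ i → a * (⌊ allowed (suc i) ⌋ * (y ^ suc i * (layer source c L (suc i) + source L (suc i)))))
        ≈⟨ Σ-cong b (λ i → trans
             (solve 5 (λ a k z f g → a :* (k :* (z :* (f :+ g))) := k :* ((a :* z) :* f :+ (a :* z) :* g)) refl a _ _ _ _)
             (trans (*-congˡ (trans (+-cong (layer-vanishing source c src L (suc i) _ (higher i)) (src L (suc i) _ (higher i))) (+-identityʳ 0#))) (zeroʳ _))) ⟩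
      Σ< b (λ _ → 0#)  ≈⟨ Σ-0 b ⟩
      0# ∎
      where
        higher : ∀ i → a * y ^ suc i * y ^ L ≈ 0#
        higher i = begin
          a * (y * y ^ i) * y ^ L  ≈⟨ solve 4 (λ a y z w → a :* (y :* z) :* w := a :* (y :* w) :* z) refl _ _ _ _ ⟩
          a * (y * y ^ L) * y ^ i  ≈⟨ trans (*-congʳ ay≈0) (zeroˡ _) ⟩
          0# ∎

    module _ (ℓ : ℕ) where

      total : (ℕ → ℕ → Carrier) → ℕ → Carrier
      total f b = Σ< ℓ (λ L → f L b)

      -- Either the largest part is at most b, or it is b + 1 and can be removed. Removal changes
      -- the length, so the recursion closes up only because lists of length `ℓ` contribute nothing.
      total-step : y ^ ℓ ≈ 0# → ∀ source c → Vanishing source → ∀ b →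
        let f = layer source c in
        total f (suc b) ≈ total f b + ⌊ allowed (suc b) ⌋ * (y ^ suc b * (total f (suc b) + total source (suc b)))
      total-step y^ℓ≈0 source c src b = trans (unfolded (suc b)) (trans (sym (+-assoc _ _ _)) (+-congʳ (sym (unfolded b))))
        where
          f = layer source c
          term : ℕ → ℕ → Carrier
          term L i = ⌊ allowed (suc i) ⌋ * (y ^ suc i * (f L (suc i) + source L (suc i)))

          unfolded : ∀ b → total f b ≈ c + Σ< b (λ i → ⌊ allowed (suc i) ⌋ * (y ^ suc i * (total f (suc i) + total source (suc i))))
          unfolded b = begin
            total f b                                ≈⟨ +-identityʳ _ ⟨
            -- The missing length `ℓ` is added as a zero term; peeling off length 0 then leaves the
            -- positive lengths up to `ℓ`, one first part ahead of the lengths below `ℓ`.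
            total f b + 0#                           ≈⟨ +-congˡ (trans (sym (*-identityˡ _)) (layer-vanishing source c src ℓ b 1# (trans (*-identityˡ _) y^ℓ≈0))) ⟨
            Σ< (suc ℓ) (λ L → f L b)                 ≈⟨ Σ-front ℓ _ ⟩
            c + Σ< ℓ (λ L → Σ< b (term L))           ≈⟨ +-congˡ (Σ-swap ℓ b term) ⟩
            c + Σ< b (λ i → Σ< ℓ (λ L → term L i))   ≈⟨ +-congˡ (Σ-cong b (λ i → trans (sym (*-distribˡ-Σ ℓ _ _))
                                                          (*-congˡ (trans (sym (*-distribˡ-Σ ℓ _ _)) (*-congˡ (Σ-+ ℓ _ _)))))) ⟩
            c + Σ< b (λ i → ⌊ allowed (suc i) ⌋ * (y ^ suc i * (total f (suc i) + total source (suc i)))) ∎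

      total-0 : ∀ source c → y ^ ℓ ≈ 0# → Vanishing source → total (layer source c) 0 ≈ c
      total-0 source c y^ℓ≈0 src = begin
        total f 0                  ≈⟨ +-identityʳ _ ⟨
        total f 0 + 0#             ≈⟨ +-congˡ (trans (sym (*-identityˡ _)) (layer-vanishing source c src ℓ 0 1# (trans (*-identityˡ _) y^ℓ≈0))) ⟨
        Σ< (suc ℓ) (λ L → f L 0)   ≈⟨ Σ-front ℓ _ ⟩
        c + Σ< ℓ (λ _ → 0#)        ≈⟨ trans (+-congˡ (Σ-0 ℓ)) (+-identityʳ c) ⟩
        c                          ∎
        where f = layer source c

  no-source : ℕ → ℕ → Carrier
  no-source L b = 0#

  module Marked (y : Carrier) (allowed : ℕ → Bool) (s : ℕ) where

    -- `marked` weighs each list by its number of parts equal to `s`: a part put on top keeps the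
    -- old count and adds one, through `source`, exactly when it is `s`.
    plain source marked : ℕ → ℕ → Carrier
    plain      = layer y allowed no-source 1#
    source L b = ⌊ b ≡ᵇ s ⌋ * plain L b
    marked     = layer y allowed source 0#

    plain-vanishing : Vanishing y allowed plain
    plain-vanishing = layer-vanishing y allowed _ _ (λ _ _ a _ → zeroʳ a)

    source-vanishing : Vanishing y allowed source
    source-vanishing L b a ay≈0 = trans (solve 3 (λ a k p → a :* (k :* p) := k :* (a :* p)) refl _ _ _)
      (trans (*-congˡ (plain-vanishing L b a ay≈0)) (zeroʳ _))

  module Totals (y : Carrier) (allowed : ℕ → Bool) (s ℓ : ℕ) (y^ℓ≈0 : y ^ ℓ ≈ 0#) where

    open Marked y allowed s public

    Z W : ℕ → Carrier
    Z = total y allowed ℓ plain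
    W = total y allowed ℓ marked

    source-total : ∀ b → total y allowed ℓ source b ≈ ⌊ b ≡ᵇ s ⌋ * Z b
    source-total b = sym (*-distribˡ-Σ ℓ _ _)

    W-step : ∀ b → W (suc b) ≈ W b + ⌊ allowed (suc b) ⌋ * (y ^ suc b * (W (suc b) + ⌊ suc b ≡ᵇ s ⌋ * Z (suc b)))
    W-step b = trans (total-step y allowed ℓ y^ℓ≈0 source 0# source-vanishing b)
      (+-congˡ (*-congˡ (*-congˡ (+-congˡ (source-total (suc b))))))

    Z-step : ∀ b → Z (suc b) ≈ Z b + ⌊ allowed (suc b) ⌋ * (y ^ suc b * Z (suc b))
    Z-step b = trans (total-step y allowed ℓ y^ℓ≈0 no-source 1# (λ _ _ a _ → zeroʳ a) b)
      (+-congˡ (*-congˡ (*-congˡ (trans (+-congˡ (Σ-0 ℓ)) (+-identityʳ _)))))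

    W-skip : ∀ b → allowed (suc b) ≡ false → W (suc b) ≈ W b
    W-skip b forbidden = begin
      W (suc b)                           ≈⟨ W-step b ⟩
      W b + ⌊ allowed (suc b) ⌋ * rhs     ≡⟨ ≡.cong (λ k → W b + ⌊ k ⌋ * rhs) forbidden ⟩
      W b + 0# * rhs                      ≈⟨ trans (+-congˡ (zeroˡ _)) (+-identityʳ _) ⟩
      W b                                 ∎
      where rhs = y ^ suc b * (W (suc b) + ⌊ suc b ≡ᵇ s ⌋ * Z (suc b))

    W-large : ∀ b → y ^ suc b ≈ 0# → W (suc b) ≈ W b
    W-large b y≈0 = trans (W-step b) (trans (+-congˡ (trans (*-congˡ (trans (*-congʳ y≈0) (zeroˡ _))) (zeroʳ _))) (+-identityʳ _))

    W-beyond : ∀ {m b} → (∀ i → m ≤ i → y ^ suc i ≈ 0#) → m ≤ b → W b ≈ W m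
    W-beyond {m} y≈0 m≤b = go (ℕ.≤⇒≤′ m≤b)
      where
        go : ∀ {b} → m ≤′ b → W b ≈ W m
        go ≤′-refl        = refl
        go (≤′-step m≤′b) = trans (W-large _ (y≈0 _ (ℕ.≤′⇒≤ m≤′b))) (go m≤′b)

    -- A part other than `s` leaves the count of `s` alone, so its repetitions only contribute a
    -- geometric factor.
    W-take : ∀ b → allowed (suc b) ≡ true → suc b ≢ s → (1# - y ^ suc b) * W (suc b) ≈ W b
    W-take b allow b≢s = begin
      (1# - y ^ suc b) * W (suc b)              ≈⟨ solve 2 (λ z w → (:1 :- z) :* w := w :- z :* w) refl _ _ ⟩
      W (suc b) - y ^ suc b * W (suc b)         ≈⟨ +-congʳ expand ⟩
      W b + y ^ suc b * W (suc b) - y ^ suc b * W (suc b)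
                                                ≈⟨ solve 2 (λ w z → w :+ z :- z := w) refl _ _ ⟩
      W b ∎
      where
        expand : W (suc b) ≈ W b + y ^ suc b * W (suc b)
        expand = begin
          W (suc b) ≈⟨ W-step b ⟩
          W b + ⌊ allowed (suc b) ⌋ * (y ^ suc b * (W (suc b) + ⌊ suc b ≡ᵇ s ⌋ * Z (suc b)))
            ≡⟨ ≡.cong₂ (λ k l → W b + ⌊ k ⌋ * (y ^ suc b * (W (suc b) + ⌊ l ⌋ * Z (suc b)))) allow (≢⇒≡ᵇ-false (suc b) s b≢s) ⟩
          W b + 1# * (y ^ suc b * (W (suc b) + 0# * Z (suc b)))
            ≈⟨ +-congˡ (trans (*-identityˡ _) (*-congˡ (trans (+-congˡ (zeroˡ _)) (+-identityʳ _)))) ⟩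
          W b + y ^ suc b * W (suc b) ∎

  module Smallest (y : Carrier) (allowed : ℕ → Bool) (σ : ℕ) (ℓ : ℕ) (y^ℓ≈0 : y ^ ℓ ≈ 0#)
    (below : ∀ i → i < suc σ → allowed i ≡ false) (at : allowed (suc σ) ≡ true)
    (w : Carrier) (w-inverse : (1# - y ^ suc σ) * w ≈ 1#) where

    open Totals y allowed (suc σ) ℓ y^ℓ≈0 public

    Z-below : ∀ b → b ≤ σ → Z b ≈ 1#
    Z-below zero    b≤σ = total-0 y allowed ℓ no-source 1# y^ℓ≈0 (λ _ _ a _ → zeroʳ a)
    Z-below (suc b) b≤σ = begin
      Z (suc b)                                                ≈⟨ Z-step b ⟩
      Z b + ⌊ allowed (suc b) ⌋ * (y ^ suc b * Z (suc b))      ≡⟨ ≡.cong (λ k → Z b + ⌊ k ⌋ * (y ^ suc b * Z (suc b))) (below (suc b) (s≤s b≤σ)) ⟩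
      Z b + 0# * (y ^ suc b * Z (suc b))                       ≈⟨ trans (+-congˡ (zeroˡ _)) (+-identityʳ _) ⟩
      Z b                                                      ≈⟨ Z-below b (ℕ.<⇒≤ b≤σ) ⟩
      1#                                                       ∎

    W-below : ∀ b → b ≤ σ → W b ≈ 0#
    W-below zero    b≤σ = total-0 y allowed ℓ source 0# y^ℓ≈0 source-vanishing
    W-below (suc b) b≤σ = trans (W-skip b (below (suc b) (s≤s b≤σ))) (W-below b (ℕ.<⇒≤ b≤σ))

    by-inverse : ∀ {x c} → x ≈ c + y ^ suc σ * x → x ≈ c * w
    by-inverse {x} {c} x≈ = begin
      x                                  ≈⟨ trans (*-congˡ w-inverse) (*-identityʳ x) ⟨
      x * ((1# - y ^ suc σ) * w)         ≈⟨ solve 3 (λ x z w → x :* ((:1 :- z) :* w) := (x :- z :* x) :* w) refl _ _ _ ⟩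
      (x - y ^ suc σ * x) * w            ≈⟨ *-congʳ (+-congʳ x≈) ⟩
      (c + y ^ suc σ * x - y ^ suc σ * x) * w  ≈⟨ *-congʳ (solve 2 (λ c z → c :+ z :- z := c) refl _ _) ⟩
      c * w                              ∎

    Z-at : Z (suc σ) ≈ w
    Z-at = trans (by-inverse (begin
      Z (suc σ)                                                ≈⟨ Z-step σ ⟩
      Z σ + ⌊ allowed (suc σ) ⌋ * (y ^ suc σ * Z (suc σ))      ≡⟨ ≡.cong (λ k → Z σ + ⌊ k ⌋ * (y ^ suc σ * Z (suc σ))) at ⟩
      Z σ + 1# * (y ^ suc σ * Z (suc σ))                       ≈⟨ +-cong (Z-below σ ℕ.≤-refl) (*-identityˡ _) ⟩
      1# + y ^ suc σ * Z (suc σ)                               ∎)) (*-identityˡ w)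

    -- Only copies of s = σ + 1 are available up to this bound, and the sum of m y^(sm) over m is
    -- y^s/(1 - y^s)².
    W-at : W (suc σ) ≈ y ^ suc σ * (w * w)
    W-at = trans (by-inverse (begin
      W (suc σ)
        ≈⟨ W-step σ ⟩
      W σ + ⌊ allowed (suc σ) ⌋ * (y ^ suc σ * (W (suc σ) + ⌊ σ ≡ᵇ σ ⌋ * Z (suc σ)))
        ≡⟨ ≡.cong₂ (λ k l → W σ + ⌊ k ⌋ * (y ^ suc σ * (W (suc σ) + ⌊ l ⌋ * Z (suc σ)))) at (≡ᵇ-refl σ) ⟩
      W σ + 1# * (y ^ suc σ * (W (suc σ) + 1# * Z (suc σ)))
        ≈⟨ +-cong (W-below σ ℕ.≤-refl) (trans (*-identityˡ _) (*-congˡ (+-congˡ (trans (*-identityˡ _) Z-at)))) ⟩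
      0# + y ^ suc σ * (W (suc σ) + w)
        ≈⟨ solve 3 (λ z x w → con 0ℤ :+ z :* (x :+ w) := z :* w :+ z :* x) refl _ _ _ ⟩
      y ^ suc σ * w + y ^ suc σ * W (suc σ) ∎)) (*-assoc _ _ _)

-- Closed forms for a fixed smallest part.

module ClosedForms (R : CommutativeRing 0ℓ 0ℓ) where
  open Sums R
  open QSeries R
  open Layers R

  module _ (q : Carrier) (u : ℕ → Carrier) (u-inverse : ∀ k → (1# - q ^ suc k) * u (suc k) ≈ 1#) where

    open Products q u u-inverse

    module _ (allowed : ℕ → Bool) (σ ℓ : ℕ) (q^ℓ≈0 : q ^ ℓ ≈ 0#)
      (below : ∀ i → i < suc σ → allowed i ≡ false)
      (middle : ∀ i → suc σ ≤ i → i ≤ double (suc σ) → allowed i ≡ true)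
      (odd : ∀ i → suc σ ≤ i → allowed (suc (double i)) ≡ false)
      (even : ∀ i → suc σ ≤ i → allowed (double i) ≡ true) where

      open Smallest q allowed σ ℓ q^ℓ≈0 below (middle (suc σ) ℕ.≤-refl (n≤double (suc σ))) (u (suc σ)) (u-inverse σ)

      private
        s = suc σ

      -- All parts from s + 1 to 2s are allowed, so raising the bound by one divides `W` by the very
      -- factor that `P` gains.
      P-W : ∀ d → d ℕ.+ s ≤ double s → P (d ℕ.+ s) * W (d ℕ.+ s) ≈ P s * W s
      P-W zero    _     = refl
      P-W (suc d) d+s<2s = begin
        P (d ℕ.+ s) * (1# - q ^ suc (d ℕ.+ s)) * W (suc (d ℕ.+ s))  ≈⟨ *-assoc _ _ _ ⟩
        P (d ℕ.+ s) * ((1# - q ^ suc (d ℕ.+ s)) * W (suc (d ℕ.+ s)))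
          ≈⟨ *-congˡ (W-take (d ℕ.+ s) (middle _ (ℕ.m≤n⇒m≤1+n (ℕ.m≤n+m s d)) d+s<2s) (>⇒≢ (s≤s (ℕ.m≤n+m s d)))) ⟩
        P (d ℕ.+ s) * W (d ℕ.+ s)                                   ≈⟨ P-W d (ℕ.<⇒≤ d+s<2s) ⟩
        P s * W s                                                   ∎

      -- Beyond 2s the bound rises in steps of two: the odd part is forbidden and changes nothing,
      -- the even part cancels the new factor of `Q`.
      Q-W : ∀ d → Q (d ℕ.+ s) * W (double (d ℕ.+ s)) ≈ Q s * W (double s)
      Q-W zero    = refl
      Q-W (suc d) = begin
        Q e * (1# - q ^ double (suc e)) * W (double (suc e))    ≈⟨ *-assoc _ _ _ ⟩
        Q e * ((1# - q ^ double (suc e)) * W (double (suc e)))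
          ≈⟨ *-congˡ (W-take (suc (double e)) (even (suc e) (ℕ.m≤n⇒m≤1+n s≤e)) (>⇒≢ (s≤s (ℕ.m≤n⇒m≤1+n (ℕ.≤-trans s≤e (n≤double e)))))) ⟩
        Q e * W (suc (double e))                                ≈⟨ *-congˡ (W-skip (double e) (odd e s≤e)) ⟩
        Q e * W (double e)                                      ≈⟨ Q-W d ⟩
        Q s * W (double s)                                      ∎
        where
          e = d ℕ.+ s
          s≤e : s ≤ e
          s≤e = ℕ.m≤n+m s d

      W-double : W (double s) ≈ U (double s) * (P s * W s)
      W-double = begin
        W (double s)                               ≈⟨ *-identityˡ _ ⟨
        1# * W (double s)                          ≈⟨ *-congʳ (PU≈1 (double s)) ⟨
        P (double s) * U (double s) * W (double s)  ≈⟨ solve 3 (λ p v w → p :* v :* w := v :* (p :* w)) refl _ _ _ ⟩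
        U (double s) * (P (double s) * W (double s))
          ≈⟨ *-congˡ (≡.subst (λ n → P n * W n ≈ P s * W s) (≡.sym (double≡n+n s)) (P-W s (ℕ.≤-reflexive (≡.sym (double≡n+n s))))) ⟩
        U (double s) * (P s * W s)               ∎

      -- `Q K` is a finite stand-in for (q²;q²)∞; by `Q-W` the product is the same for every K ≥ s.
      Q-W-admissible : ∀ K → s ≤ K → Q K * W (double K) ≈ B s * U s
      Q-W-admissible K s≤K = begin
        Q K * W (double K)                        ≡⟨ ≡.cong (λ n → Q n * W (double n)) (≡.sym (ℕ.m∸n+n≡m s≤K)) ⟩
        Q (K ℕ.∸ s ℕ.+ s) * W (double (K ℕ.∸ s ℕ.+ s))  ≈⟨ Q-W (K ℕ.∸ s) ⟩
        Q s * W (double s)                        ≈⟨ *-congˡ (trans W-double (*-cong (U-double s) (*-congˡ W-at))) ⟩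
        Q s * (O s * V s * (P σ * f * (q ^ s * (w * w))))
          ≈⟨ solve 7 (λ Q O V P f x w → Q :* (O :* V :* (P :* f :* (x :* (w :* w)))) := (Q :* V) :* (f :* w) :* (x :* P :* O :* w)) refl _ _ _ _ _ _ _ ⟩
        (Q s * V s) * (f * w) * (q ^ s * P σ * O s * w)
          -- The two unit products are traded for `P σ * U σ`, which supplies the second `P σ` of
          -- `B s` and the `U σ` that `w` completes to `U s`.
          ≈⟨ *-congʳ (trans (*-cong (QV≈1 s) (u-inverse σ)) (trans (*-identityʳ 1#) (sym (PU≈1 σ)))) ⟩
        P σ * U σ * (q ^ s * P σ * O s * w)
          ≈⟨ solve 5 (λ P U x O w → P :* U :* (x :* P :* O :* w) := x :* (P :* P) :* O :* (U :* w)) refl _ _ _ _ _ ⟩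
        q ^ s * (P σ * P σ) * O s * (U σ * w)  ∎
        where
          w = u s
          f = 1# - q ^ s

    module _ (y : Carrier) (y^≈ : ∀ i → y ^ i ≈ q ^ double i) (allowed : ℕ → Bool) (σ ℓ : ℕ) (y^ℓ≈0 : y ^ ℓ ≈ 0#)
      (below : ∀ i → i < suc σ → allowed i ≡ false)
      (above : ∀ i → suc σ ≤ i → allowed i ≡ true) where

      private
        s = suc σ
        w = u (double s)

        w-inverse : (1# - y ^ s) * w ≈ 1#
        w-inverse = trans (*-congʳ (+-congˡ (-‿cong (y^≈ s)))) (u-inverse (suc (double σ)))

      open Smallest y allowed σ ℓ y^ℓ≈0 below (above s ℕ.≤-refl) w w-inverse

      Q-W-even : ∀ d → Q (d ℕ.+ s) * W (d ℕ.+ s) ≈ Q s * W s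
      Q-W-even zero    = refl
      Q-W-even (suc d) = begin
        Q e * (1# - q ^ double (suc e)) * W (suc e)    ≈⟨ *-assoc _ _ _ ⟩
        Q e * ((1# - q ^ double (suc e)) * W (suc e))  ≈⟨ *-congˡ (*-congʳ (+-congˡ (-‿cong (y^≈ (suc e))))) ⟨
        Q e * ((1# - y ^ suc e) * W (suc e))           ≈⟨ *-congˡ (W-take e (above (suc e) (ℕ.m≤n⇒m≤1+n (ℕ.m≤n+m s d))) (>⇒≢ (s≤s (ℕ.m≤n+m s d)))) ⟩
        Q e * W e                                      ≈⟨ Q-W-even d ⟩
        Q s * W s                                      ∎
        where e = d ℕ.+ s

      Q-W-spt : ∀ K → s ≤ K → Q K * W K ≈ T σ
      Q-W-spt K s≤K = begin
        Q K * W K                                   ≡⟨ ≡.cong (λ n → Q n * W n) (≡.sym (ℕ.m∸n+n≡m s≤K)) ⟩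
        Q (K ℕ.∸ s ℕ.+ s) * W (K ℕ.∸ s ℕ.+ s)       ≈⟨ Q-W-even (K ℕ.∸ s) ⟩
        Q s * W s                                   ≈⟨ *-congˡ (trans W-at (*-congʳ (y^≈ s))) ⟩
        Q σ * f * (q ^ double s * (w * w))          ≈⟨ solve 4 (λ Q f x w → Q :* f :* (x :* (w :* w)) := f :* w :* (x :* w :* Q)) refl _ _ _ _ ⟩
        f * w * (q ^ double s * w * Q σ)            ≈⟨ *-congʳ (trans (u-inverse (suc (double σ))) (sym (QV≈1 σ))) ⟩
        Q σ * V σ * (q ^ double s * w * Q σ)      ≈⟨ solve 4 (λ Q V x w → Q :* V :* (x :* w :* Q) := x :* (V :* w) :* (Q :* Q)) refl _ _ _ _ ⟩
        q ^ double s * (V σ * w) * (Q σ * Q σ)    ∎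
        where f = 1# - q ^ double s

-- Formal power series over ℤ and their truncations.

module PowerSeries where

  open ≡ using (refl; cong; cong₂; module ≡-Reasoning)
  open import Algebra.Properties.CommutativeSemigroup (CommutativeMonoid.commutativeSemigroup ℤ.+-0-commutativeMonoid) using (interchange)

  Series : Set
  Series = ℕ → ℤ

  infixl 7 _⊛_ _·_
  infixl 6 _⊞_

  -- `_⊛_` is the Cauchy product, by recursion along f = f(0) + q · `tail f`.
  _⊞_ _⊛_ : Series → Series → Series
  (f ⊞ g) n       = f n ℤ.+ g n
  (f ⊛ g) zero    = f 0 ℤ.* g 0
  (f ⊛ g) (suc n) = f 0 ℤ.* g (suc n) ℤ.+ ((λ i → f (suc i)) ⊛ g) n

  _·_ : ℤ → Series → Series
  (a · f) n = a ℤ.* f n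

  tail : Series → Series
  tail f n = f (suc n)

  zeros one var : Series
  zeros n = 0ℤ
  one zero    = 1ℤ
  one (suc n) = 0ℤ
  var zero    = 0ℤ
  var (suc n) = one n

  -- A product coefficient depends only on coefficients of at most its own degree; this makes the
  -- product respect equality up to degree N.
  ⊛-local : ∀ n {f f′ g g′} → (∀ i → i ≤ n → f i ≡ f′ i) → (∀ i → i ≤ n → g i ≡ g′ i) → (f ⊛ g) n ≡ (f′ ⊛ g′) n
  ⊛-local zero    f≗ g≗ = cong₂ ℤ._*_ (f≗ 0 z≤n) (g≗ 0 z≤n)
  ⊛-local (suc n) f≗ g≗ = cong₂ ℤ._+_ (cong₂ ℤ._*_ (f≗ 0 z≤n) (g≗ (suc n) ℕ.≤-refl))
    (⊛-local n (λ i i≤n → f≗ (suc i) (s≤s i≤n)) (λ i i≤n → g≗ i (ℕ.m≤n⇒m≤1+n i≤n)))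

  ⊛-distribʳ : ∀ h f g → (f ⊞ g) ⊛ h ≗ f ⊛ h ⊞ g ⊛ h
  ⊛-distribʳ h f g zero    = ℤ.*-distribʳ-+ (h 0) (f 0) (g 0)
  ⊛-distribʳ h f g (suc n) = ≡.trans
    (cong₂ ℤ._+_ (ℤ.*-distribʳ-+ (h (suc n)) (f 0) (g 0)) (⊛-distribʳ h (tail f) (tail g) n))
    (interchange (f 0 ℤ.* h (suc n)) _ _ _)

  ·-⊛ : ∀ a f g → (a · f) ⊛ g ≗ a · (f ⊛ g)
  ·-⊛ a f g zero    = ℤ.*-assoc a (f 0) (g 0)
  ·-⊛ a f g (suc n) = ≡.trans (cong₂ ℤ._+_ (ℤ.*-assoc a (f 0) _) (·-⊛ a (tail f) g n)) (≡.sym (ℤ.*-distribˡ-+ a _ _))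

  -- The recursion that peels the right factor instead; comparing it with the defining one yields
  -- commutativity.
  ⊛-tailʳ : ∀ f g n → (f ⊛ g) (suc n) ≡ (f ⊛ tail g) n ℤ.+ f (suc n) ℤ.* g 0
  ⊛-tailʳ f g zero    = refl
  ⊛-tailʳ f g (suc n) = ≡.trans (cong (ℤ._+_ (f 0 ℤ.* g (suc (suc n)))) (⊛-tailʳ (tail f) g n)) (≡.sym (ℤ.+-assoc (f 0 ℤ.* g (suc (suc n))) _ _))

  ⊛-comm : ∀ f g → f ⊛ g ≗ g ⊛ f
  ⊛-comm f g zero    = ℤ.*-comm (f 0) (g 0)
  ⊛-comm f g (suc n) = begin
    f 0 ℤ.* g (suc n) ℤ.+ (tail f ⊛ g) n  ≡⟨ cong₂ ℤ._+_ (ℤ.*-comm (f 0) _) (⊛-comm (tail f) g n) ⟩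
    g (suc n) ℤ.* f 0 ℤ.+ (g ⊛ tail f) n  ≡⟨ ℤ.+-comm (g (suc n) ℤ.* f 0) _ ⟩
    (g ⊛ tail f) n ℤ.+ g (suc n) ℤ.* f 0  ≡⟨ ⊛-tailʳ g f n ⟨
    (g ⊛ f) (suc n)                       ∎
    where open ≡-Reasoning

  ⊛-assoc : ∀ f g h → (f ⊛ g) ⊛ h ≗ f ⊛ (g ⊛ h)
  ⊛-assoc f g h zero    = ℤ.*-assoc (f 0) (g 0) (h 0)
  ⊛-assoc f g h (suc n) = begin
    f 0 ℤ.* g 0 ℤ.* h (suc n) ℤ.+ ((f 0 · tail g ⊞ tail f ⊛ g) ⊛ h) n
      ≡⟨ cong₂ ℤ._+_ (ℤ.*-assoc (f 0) (g 0) _) (⊛-distribʳ h (f 0 · tail g) (tail f ⊛ g) n) ⟩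
    f 0 ℤ.* (g 0 ℤ.* h (suc n)) ℤ.+ (((f 0 · tail g) ⊛ h) n ℤ.+ ((tail f ⊛ g) ⊛ h) n)
      ≡⟨ cong (ℤ._+_ (f 0 ℤ.* (g 0 ℤ.* h (suc n)))) (cong₂ ℤ._+_ (·-⊛ (f 0) (tail g) h n) (⊛-assoc (tail f) g h n)) ⟩
    f 0 ℤ.* (g 0 ℤ.* h (suc n)) ℤ.+ (f 0 ℤ.* (tail g ⊛ h) n ℤ.+ (tail f ⊛ (g ⊛ h)) n)
      ≡⟨ ℤ.+-assoc (f 0 ℤ.* (g 0 ℤ.* h (suc n))) _ _ ⟨
    f 0 ℤ.* (g 0 ℤ.* h (suc n)) ℤ.+ f 0 ℤ.* (tail g ⊛ h) n ℤ.+ (tail f ⊛ (g ⊛ h)) n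
      ≡⟨ cong (ℤ._+ (tail f ⊛ (g ⊛ h)) n) (ℤ.*-distribˡ-+ (f 0) _ _) ⟨
    (f ⊛ (g ⊛ h)) (suc n) ∎
    where open ≡-Reasoning

  ⊛-zeroˡ : ∀ f → zeros ⊛ f ≗ zeros
  ⊛-zeroˡ f zero    = ℤ.*-zeroˡ (f 0)
  ⊛-zeroˡ f (suc n) = cong₂ ℤ._+_ (ℤ.*-zeroˡ (f (suc n))) (⊛-zeroˡ f n)

  ⊛-identityˡ : ∀ f → one ⊛ f ≗ f
  ⊛-identityˡ f zero    = ℤ.*-identityˡ (f 0)
  ⊛-identityˡ f (suc n) = ≡.trans (cong₂ ℤ._+_ (ℤ.*-identityˡ (f (suc n))) (⊛-zeroˡ f n)) (ℤ.+-identityʳ _)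

  ⊛-identityʳ : ∀ f → f ⊛ one ≗ f
  ⊛-identityʳ f n = ≡.trans (⊛-comm f one n) (⊛-identityˡ f n)

  ⊛-distribˡ : ∀ h f g → h ⊛ (f ⊞ g) ≗ h ⊛ f ⊞ h ⊛ g
  ⊛-distribˡ h f g n = ≡.trans (⊛-comm h _ n) (≡.trans (⊛-distribʳ h f g n) (cong₂ ℤ._+_ (⊛-comm f h n) (⊛-comm g h n)))

  var-⊛ : ∀ f n → (var ⊛ f) (suc n) ≡ f n
  var-⊛ f n = ≡.trans (cong₂ ℤ._+_ (ℤ.*-zeroˡ (f (suc n))) (⊛-identityˡ f n)) (ℤ.+-identityˡ _)

  -- ℤ[[q]] / (q ^ (N + 1)), with series identified when they agree up to degree N.
  truncatedSeries : ℕ → CommutativeRing 0ℓ 0ℓ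
  truncatedSeries N = record
    { Carrier = Series
    ; _≈_     = λ f g → ∀ i → i ≤ N → f i ≡ g i
    ; _+_     = _⊞_
    ; _*_     = _⊛_
    ; -_      = λ f n → ℤ.- f n
    ; 0#      = zeros
    ; 1#      = one
    ; isCommutativeRing = record
      { isRing = record
        { +-isAbelianGroup = record
          { isGroup = record
            { isMonoid = record
              { isSemigroup = record
                { isMagma = record
                  { isEquivalence = record
                    { refl  = λ _ _ → refl
                    ; sym   = λ f≈g i i≤N → ≡.sym (f≈g i i≤N)
                    ; trans = λ f≈g g≈h i i≤N → ≡.trans (f≈g i i≤N) (g≈h i i≤N)
                    }
                  ; ∙-cong = λ f≈ g≈ i i≤N → cong₂ ℤ._+_ (f≈ i i≤N) (g≈ i i≤N)
                  }
                ; assoc = λ f g h i _ → ℤ.+-assoc (f i) (g i) (h i)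
                }
              ; identity = (λ f i _ → ℤ.+-identityˡ (f i)) , (λ f i _ → ℤ.+-identityʳ (f i))
              }
            ; inverse = (λ f i _ → ℤ.+-inverseˡ (f i)) , (λ f i _ → ℤ.+-inverseʳ (f i))
            ; ⁻¹-cong = λ f≈g i i≤N → cong ℤ.-_ (f≈g i i≤N)
            }
          ; comm = λ f g i _ → ℤ.+-comm (f i) (g i)
          }
        ; *-cong = λ f≈ g≈ i i≤N → ⊛-local i (λ j j≤i → f≈ j (ℕ.≤-trans j≤i i≤N)) (λ j j≤i → g≈ j (ℕ.≤-trans j≤i i≤N))
        ; *-assoc = λ f g h i _ → ⊛-assoc f g h i
        ; *-identity = (λ f i _ → ⊛-identityˡ f i) , (λ f i _ → ⊛-identityʳ f i)
        ; distrib = (λ h f g i _ → ⊛-distribˡ h f g i) , (λ h f g i _ → ⊛-distribʳ h f g i)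
        }
      ; *-comm = λ f g i _ → ⊛-comm f g i
      }
    }

-- From the enumerated partitions to counts by smallest part.

module Enumerations where

  open import Data.Product using (_×_)
  open ≡ using (refl; sym; trans; cong; cong₂; module ≡-Reasoning)
  open ≡-Reasoning
  open import Data.Nat using (_+_; _∸_)
  open FiniteSums ℕ.+-0-commutativeMonoid
    renaming (Σ< to Σℕ; Σ-cong to Σℕ-cong; Σ-cong< to Σℕ-cong<; Σ-0 to Σℕ-0; Σ-swap to Σℕ-swap;
              Σ-front to Σℕ-front; Σ-truncate to Σℕ-truncate; Σ-single to Σℕ-single)

  -- The coefficients of `layer`: multiplication by y^(i+1) becomes the test i + 1 ≤ t and the
  -- passage from t to t - (i + 1).
  layerℕ : (ℕ → Bool) → (ℕ → ℕ → ℕ → ℕ) → (ℕ → ℕ) → ℕ → ℕ → ℕ → ℕ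
  layerℕ allowed source c zero    b t = c t
  layerℕ allowed source c (suc L) b t = Σℕ b λ i →
    if allowed (suc i) then (if suc i ≤ᵇ t then layerℕ allowed source c L (suc i) (t ℕ.∸ suc i) ℕ.+ source L (suc i) (t ℕ.∸ suc i) else 0) else 0

  if-else-0 : ∀ (b : Bool) → (if b then 0 else 0) ≡ 0
  if-else-0 true  = refl
  if-else-0 false = refl

  if-∧ : ∀ a b {n : ℕ} → (if a ∧ b then n else 0) ≡ (if a then (if b then n else 0) else 0)
  if-∧ true  b = refl
  if-∧ false b = refl

  if-cong : ∀ b {m n : ℕ} → m ≡ n → (if b then m else 0) ≡ (if b then n else 0)
  if-cong b = cong (λ n → if b then n else 0)

  ≤ᵇ-true⇒≤ : ∀ m n → (m ≤ᵇ n) ≡ true → m ≤ n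
  ≤ᵇ-true⇒≤ m n eq = ℕ.≤ᵇ⇒≤ m n (≡.subst Bool.T (sym eq) tt)

  ≡ᵇ-true⇒≡ : ∀ m n → (m ≡ᵇ n) ≡ true → m ≡ n
  ≡ᵇ-true⇒≡ m n eq = ℕ.≡ᵇ⇒≡ m n (≡.subst Bool.T (sym eq) tt)

  ∧-true : ∀ a b → a ∧ b ≡ true → a ≡ true × b ≡ true
  ∧-true true true refl = refl , refl

  Σᴸ : {A : Set} → List A → (A → ℕ) → ℕ
  Σᴸ xs f = sum (map f xs)

  Σᴸ-cong : ∀ {A : Set} (xs : List A) {f g : A → ℕ} → (∀ x → f x ≡ g x) → Σᴸ xs f ≡ Σᴸ xs g
  Σᴸ-cong []       f≡g = refl
  Σᴸ-cong (x ∷ xs) f≡g = cong₂ _+_ (f≡g x) (Σᴸ-cong xs f≡g)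

  Σᴸ-+ : ∀ {A : Set} (xs : List A) (f g : A → ℕ) → Σᴸ xs (λ x → f x + g x) ≡ Σᴸ xs f + Σᴸ xs g
  Σᴸ-+ []       f g = refl
  Σᴸ-+ (x ∷ xs) f g = trans (cong (_+_ (f x + g x)) (Σᴸ-+ xs f g)) (interchange (f x) (g x) _ _)
    where open import Algebra.Properties.CommutativeSemigroup ℕ.+-commutativeSemigroup using (interchange)

  Σᴸ-0 : ∀ {A : Set} (xs : List A) → Σᴸ xs (λ _ → 0) ≡ 0
  Σᴸ-0 []       = refl
  Σᴸ-0 (x ∷ xs) = Σᴸ-0 xs

  Σᴸ-if : ∀ {A : Set} (xs : List A) (b : Bool) (f : A → ℕ) → Σᴸ xs (λ x → if b then f x else 0) ≡ (if b then Σᴸ xs f else 0)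
  Σᴸ-if xs true  f = refl
  Σᴸ-if xs false f = Σᴸ-0 xs

  Σᴸ-Σℕ : ∀ {A : Set} (xs : List A) n (f : A → ℕ → ℕ) → Σᴸ xs (λ x → Σℕ n (f x)) ≡ Σℕ n (λ i → Σᴸ xs (λ x → f x i))
  Σᴸ-Σℕ xs zero    f = Σᴸ-0 xs
  Σᴸ-Σℕ xs (suc n) f = trans (Σᴸ-+ xs _ _) (cong (_+ Σᴸ xs (λ x → f x n)) (Σᴸ-Σℕ xs n f))

  Σᴸ-concatMap : ∀ {A B : Set} (h : A → List B) xs f → Σᴸ (concatMap h xs) f ≡ Σᴸ xs (λ x → Σᴸ (h x) f)
  Σᴸ-concatMap h []       f = refl
  Σᴸ-concatMap h (x ∷ xs) f = begin
    Σᴸ (h x ++ concatMap h xs) f                 ≡⟨ cong sum (map-++ f (h x) _) ⟩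
    sum (map f (h x) ++ map f (concatMap h xs))  ≡⟨ sum-++ (map f (h x)) _ ⟩
    Σᴸ (h x) f + Σᴸ (concatMap h xs) f           ≡⟨ cong (_+_ (Σᴸ (h x) f)) (Σᴸ-concatMap h xs f) ⟩
    Σᴸ (h x) f + Σᴸ xs (λ x → Σᴸ (h x) f)        ∎

  Σᴸ-applyUpTo : ∀ {A : Set} (h : ℕ → A) n f → Σᴸ (applyUpTo h n) f ≡ Σℕ n (f ∘ h)
  Σᴸ-applyUpTo h zero    f = refl
  Σᴸ-applyUpTo h (suc n) f = trans (cong (_+_ (f (h 0))) (Σᴸ-applyUpTo (h ∘ suc) n f)) (sym (Σℕ-front n (f ∘ h)))

  Σᴸ-filterᵇ : ∀ {A : Set} (p : A → Bool) xs f → Σᴸ (filterᵇ p xs) f ≡ Σᴸ xs (λ x → if p x then f x else 0)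
  Σᴸ-filterᵇ p []       f = refl
  Σᴸ-filterᵇ p (x ∷ xs) f with p x
  ... | true  = cong (_+_ (f x)) (Σᴸ-filterᵇ p xs f)
  ... | false = Σᴸ-filterᵇ p xs f

  Σℕ-if : ∀ n (b : Bool) f → Σℕ n (λ i → if b then f i else 0) ≡ (if b then Σℕ n f else 0)
  Σℕ-if n true  f = refl
  Σℕ-if n false f = Σℕ-0 n

  Σℕ-≤ᵇ : ∀ {b n} → b ≤ n → ∀ f → Σℕ n (λ i → if suc i ≤ᵇ b then f i else 0) ≡ Σℕ b f
  Σℕ-≤ᵇ {b} b≤n f = trans
    (Σℕ-truncate _ b≤n (λ i b≤i → cong (if_then f i else 0) (<⇒≤ᵇ-false (s≤s b≤i))))
    (Σℕ-cong< b (λ i i<b → cong (if_then f i else 0) (≤⇒≤ᵇ i<b)))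

  all : (ℕ → Bool) → List ℕ → Bool
  all p = foldr (λ x b → p x ∧ b) true

  headAtMost : ℕ → List ℕ → Bool
  headAtMost b []      = true
  headAtMost b (x ∷ _) = x ≤ᵇ b

  nonincreasing-∷ : ∀ x π → nonincreasing (x ∷ π) ≡ headAtMost x π ∧ nonincreasing π
  nonincreasing-∷ x []      = refl
  nonincreasing-∷ x (y ∷ π) = refl

  countOf : ℕ → List ℕ → ℕ
  countOf s π = length (filterᵇ (λ p → p ≡ᵇ s) π)

  countOf-∷ : ∀ s x π → countOf s (x ∷ π) ≡ countOf s π + (if x ≡ᵇ s then 1 else 0)
  countOf-∷ s x π with x ≡ᵇ s
  ... | true  = ℕ.+-comm 1 _
  ... | false = sym (ℕ.+-identityʳ _)

  +-≡ᵇ : ∀ x k t → (x + k ≡ᵇ t) ≡ (x ≤ᵇ t) ∧ (k ≡ᵇ t ∸ x)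
  +-≡ᵇ zero          k t       = refl
  +-≡ᵇ (suc x)       k zero    = refl
  +-≡ᵇ (suc zero)    k (suc t) = refl
  +-≡ᵇ (suc (suc x)) k (suc t) = +-≡ᵇ (suc x) k t

  module Enumeration (allowed : ℕ → Bool) where

    valid : ℕ → ℕ → List ℕ → Bool
    valid b t π = (headAtMost b π ∧ nonincreasing π) ∧ (all allowed π ∧ (sum π ≡ᵇ t))

    -- Removing the first part x turns bound and sum (b, t) into (x, t - x). The explicit bound is
    -- what makes the condition on the tail one of the same kind.
    valid-∷ : ∀ b t x π → valid b t (x ∷ π) ≡ (x ≤ᵇ b) ∧ (allowed x ∧ ((x ≤ᵇ t) ∧ valid x (t ∸ x) π))
    valid-∷ b t x π rewrite nonincreasing-∷ x π | +-≡ᵇ x (sum π) t =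
      rearrange (x ≤ᵇ b) (headAtMost x π ∧ nonincreasing π) (allowed x) (all allowed π) (x ≤ᵇ t) (sum π ≡ᵇ t ∸ x)
      where
        rearrange : ∀ a h k l c d → (a ∧ h) ∧ ((k ∧ l) ∧ (c ∧ d)) ≡ a ∧ (k ∧ (c ∧ (h ∧ (l ∧ d))))
        rearrange false h k     l c     d = refl
        rearrange true  h false l c     d = ∧-zeroʳ h
        rearrange true  h true  l false d = trans (cong (h ∧_) (∧-zeroʳ l)) (∧-zeroʳ h)
        rearrange true  h true  l true  d = refl

    weigh : (List ℕ → ℕ) → ℕ → ℕ → List ℕ → ℕ
    weigh w b t π = if valid b t π then w π else 0

    module _ (M : ℕ) (w : List ℕ → ℕ) (source : ℕ → ℕ → ℕ → ℕ)
      (source-correct : ∀ L x t → x ≤ M →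
        Σᴸ (listsOf L M) (λ π → if valid x t π then w (x ∷ π) else 0) ≡ Σᴸ (listsOf L M) (weigh w x t) + source L x t) where

      initial : ℕ → ℕ
      initial t = if 0 ≡ᵇ t then w [] else 0

      -- `source-correct` records how the weight changes when x is put on top. Counting lists and
      -- counting occurrences of s are the two instances, with the first serving as the source of
      -- the second.
      Σ-listsOf : ∀ L b t → b ≤ M → Σᴸ (listsOf L M) (weigh w b t) ≡ layerℕ allowed source initial L b t
      Σ-listsOf zero    b t b≤M = ℕ.+-identityʳ _
      Σ-listsOf (suc L) b t b≤M = begin
        Σᴸ (concatMap (λ x → map (x ∷_) (listsOf L M)) (applyUpTo suc M)) (weigh w b t)
          ≡⟨ Σᴸ-concatMap _ (applyUpTo suc M) _ ⟩
        Σᴸ (applyUpTo suc M) (λ x → Σᴸ (map (x ∷_) (listsOf L M)) (weigh w b t))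
          ≡⟨ Σᴸ-applyUpTo suc M _ ⟩
        Σℕ M (λ i → Σᴸ (map (suc i ∷_) (listsOf L M)) (weigh w b t))
          ≡⟨ Σℕ-cong M (λ i → peel (suc i)) ⟩
        Σℕ M (λ i → if suc i ≤ᵇ b then peeled (suc i) else 0)
          ≡⟨ Σℕ-≤ᵇ b≤M (peeled ∘ suc) ⟩
        Σℕ b (peeled ∘ suc)
          ≡⟨ Σℕ-cong< b (λ i i<b → if-cong (allowed (suc i)) (if-cong (suc i ≤ᵇ t) (trans
               (source-correct L (suc i) (t ∸ suc i) (ℕ.≤-trans i<b b≤M))
               (cong (_+ source L (suc i) (t ∸ suc i)) (Σ-listsOf L (suc i) (t ∸ suc i) (ℕ.≤-trans i<b b≤M)))))) ⟩
        layerℕ allowed source initial (suc L) b t ∎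
        where
          top : ℕ → List ℕ → ℕ
          top x π = if valid x (t ∸ x) π then w (x ∷ π) else 0

          peeled : ℕ → ℕ
          peeled x = if allowed x then (if x ≤ᵇ t then Σᴸ (listsOf L M) (top x) else 0) else 0

          peel : ∀ x → Σᴸ (map (x ∷_) (listsOf L M)) (weigh w b t) ≡ (if x ≤ᵇ b then peeled x else 0)
          peel x = begin
            Σᴸ (map (x ∷_) (listsOf L M)) (weigh w b t)
              ≡⟨ cong sum (map-∘ (listsOf L M)) ⟨
            Σᴸ (listsOf L M) (λ π → weigh w b t (x ∷ π))
              ≡⟨ Σᴸ-cong (listsOf L M) (λ π → trans (cong (if_then w (x ∷ π) else 0) (valid-∷ b t x π))
                   (trans (if-∧ (x ≤ᵇ b) _) (if-cong (x ≤ᵇ b) (trans (if-∧ (allowed x) _) (if-cong (allowed x) (if-∧ (x ≤ᵇ t) _)))))) ⟩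
            Σᴸ (listsOf L M) (λ π → if x ≤ᵇ b then (if allowed x then (if x ≤ᵇ t then top x π else 0) else 0) else 0)
              ≡⟨ trans (Σᴸ-if (listsOf L M) (x ≤ᵇ b) _) (if-cong (x ≤ᵇ b) (trans (Σᴸ-if (listsOf L M) (allowed x) _) (if-cong (allowed x) (Σᴸ-if (listsOf L M) (x ≤ᵇ t) _)))) ⟩
            (if x ≤ᵇ b then peeled x else 0) ∎

    noSource plainℕ : ℕ → ℕ → ℕ → ℕ
    noSource L b t = 0
    plainℕ = layerℕ allowed noSource (λ t → if 0 ≡ᵇ t then 1 else 0)

    sourceℕ markedℕ : ℕ → ℕ → ℕ → ℕ → ℕ
    sourceℕ s L b t = if b ≡ᵇ s then plainℕ L b t else 0
    markedℕ s = layerℕ allowed (sourceℕ s) (λ _ → 0)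

    Σ-plain : ∀ M L b t → b ≤ M → Σᴸ (listsOf L M) (weigh (λ _ → 1) b t) ≡ plainℕ L b t
    Σ-plain M = Σ-listsOf M (λ _ → 1) noSource (λ L x t x≤M → sym (ℕ.+-identityʳ _))

    layerℕ-cong : ∀ source {c c′} → (∀ t → c t ≡ c′ t) → ∀ L b t → layerℕ allowed source c L b t ≡ layerℕ allowed source c′ L b t
    layerℕ-cong source c≡c′ zero    b t = c≡c′ t
    layerℕ-cong source c≡c′ (suc L) b t = Σℕ-cong b (λ i → if-cong (allowed (suc i)) (if-cong (suc i ≤ᵇ t)
      (cong (_+ source L (suc i) (t ∸ suc i)) (layerℕ-cong source c≡c′ L (suc i) (t ∸ suc i)))))

    Σ-marked : ∀ s M L b t → b ≤ M → Σᴸ (listsOf L M) (weigh (countOf s) b t) ≡ markedℕ s L b t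
    Σ-marked s M L b t b≤M = trans (Σ-listsOf M (countOf s) (sourceℕ s) correct L b t b≤M)
      (layerℕ-cong (sourceℕ s) (λ t → if-else-0 (0 ≡ᵇ t)) L b t)
      where
        split : ∀ (k : Bool) m (j : Bool) → (if k then m + (if j then 1 else 0) else 0) ≡ (if k then m else 0) + (if j then (if k then 1 else 0) else 0)
        split true  m j     = refl
        split false m true  = refl
        split false m false = refl

        correct : ∀ L x t → x ≤ M → Σᴸ (listsOf L M) (λ π → if valid x t π then countOf s (x ∷ π) else 0)
                                  ≡ Σᴸ (listsOf L M) (weigh (countOf s) x t) + sourceℕ s L x t
        correct L x t x≤M = begin
          Σᴸ (listsOf L M) (λ π → if valid x t π then countOf s (x ∷ π) else 0)
            ≡⟨ Σᴸ-cong (listsOf L M) (λ π → trans (if-cong (valid x t π) (countOf-∷ s x π)) (split (valid x t π) _ (x ≡ᵇ s))) ⟩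
          Σᴸ (listsOf L M) (λ π → weigh (countOf s) x t π + (if x ≡ᵇ s then weigh (λ _ → 1) x t π else 0))
            ≡⟨ Σᴸ-+ (listsOf L M) _ _ ⟩
          Σᴸ (listsOf L M) (weigh (countOf s) x t) + Σᴸ (listsOf L M) (λ π → if x ≡ᵇ s then weigh (λ _ → 1) x t π else 0)
            ≡⟨ cong (_+_ (Σᴸ (listsOf L M) (weigh (countOf s) x t))) (trans (Σᴸ-if (listsOf L M) (x ≡ᵇ s) _) (if-cong (x ≡ᵇ s) (Σ-plain M L x t x≤M))) ⟩
          Σᴸ (listsOf L M) (weigh (countOf s) x t) + sourceℕ s L x t ∎

    layerℕ-bound : ∀ source c L {b t} → t ≤ b → layerℕ allowed source c L b t ≡ layerℕ allowed source c L t t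
    layerℕ-bound source c zero    t≤b = refl
    layerℕ-bound source c (suc L) {t = t} t≤b = Σℕ-truncate _ t≤b (λ i t≤i → trans
      (if-cong (allowed (suc i)) (cong (if_then layerℕ allowed source c L (suc i) (t ∸ suc i) + source L (suc i) (t ∸ suc i) else 0) (<⇒≤ᵇ-false (s≤s t≤i)))) (if-else-0 (allowed (suc i))))

    -- Every part is at least 1, so L parts need t ≥ L; the ring counterpart is `layer-vanishing`.
    layerℕ-long : ∀ source c → (∀ L b t → t < L → source L b t ≡ 0) → ∀ L b t → t < L → layerℕ allowed source c L b t ≡ 0
    layerℕ-long source c short (suc L) b t t<1+L = trans
      (Σℕ-cong b (λ i → trans (if-cong (allowed (suc i)) (fits i (suc i ≤ᵇ t) refl)) (if-else-0 (allowed (suc i))))) (Σℕ-0 b)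
      where
        fits : ∀ i k → (suc i ≤ᵇ t) ≡ k →
          (if k then layerℕ allowed source c L (suc i) (t ∸ suc i) + source L (suc i) (t ∸ suc i) else 0) ≡ 0
        fits i false _  = refl
        fits i true  eq = cong₂ _+_ (layerℕ-long source c short L _ _ shorter) (short L _ _ shorter)
          where
            i<t : i < t
            i<t = ≤ᵇ-true⇒≤ (suc i) t eq
            shorter : t ∸ suc i < L
            shorter = ℕ.<-≤-trans (ℕ.∸-monoʳ-< (s≤s z≤n) i<t) (ℕ.s≤s⁻¹ t<1+L)

    markedℕ-long : ∀ s L b t → t < L → markedℕ s L b t ≡ 0
    markedℕ-long s = layerℕ-long (sourceℕ s) _ (λ L b t t<L → trans
      (if-cong (b ≡ᵇ s) (layerℕ-long noSource _ (λ _ _ _ _ → refl) L b t t<L)) (if-else-0 (b ≡ᵇ s)))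

    occurrences : ℕ → ℕ → ℕ
    occurrences s k = Σᴸ (candidates k) (weigh (countOf s) k k)

    -- `candidates k` bounds parts and lengths by k itself, while the coefficients of one series
    -- share their bounds. Parts or lengths above k add nothing in degree k, so one m serves all k ≤
    -- m.
    occurrences-markedℕ : ∀ s {k m} → k ≤ m → occurrences s k ≡ Σℕ (suc m) (λ L → markedℕ s L m k)
    occurrences-markedℕ s {k} {m} k≤m = begin
      Σᴸ (candidates k) (weigh (countOf s) k k)
        ≡⟨ Σᴸ-concatMap (λ L → listsOf L k) (applyUpTo (λ i → i) (suc k)) _ ⟩
      Σᴸ (applyUpTo (λ i → i) (suc k)) (λ L → Σᴸ (listsOf L k) (weigh (countOf s) k k))
        ≡⟨ Σᴸ-applyUpTo (λ i → i) (suc k) _ ⟩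
      Σℕ (suc k) (λ L → Σᴸ (listsOf L k) (weigh (countOf s) k k))
        ≡⟨ Σℕ-cong (suc k) (λ L → trans (Σ-marked s k L k k ℕ.≤-refl) (sym (layerℕ-bound _ _ L k≤m))) ⟩
      Σℕ (suc k) (λ L → markedℕ s L m k)
        ≡⟨ Σℕ-truncate _ (s≤s k≤m) (λ L k<L → markedℕ-long s L m k k<L) ⟨
      Σℕ (suc m) (λ L → markedℕ s L m k) ∎

  foldr-⊓-≤ : ∀ x π → foldr _⊓_ x π ≤ x
  foldr-⊓-≤ x []      = ℕ.≤-refl
  foldr-⊓-≤ x (y ∷ π) = ℕ.≤-trans (ℕ.m⊓n≤n y _) (foldr-⊓-≤ x π)

  foldr-⊓-lower : ∀ x π → All (foldr _⊓_ x π ≤_) π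
  foldr-⊓-lower x []      = []
  foldr-⊓-lower x (y ∷ π) = ℕ.m⊓n≤m y _ ∷ All.map (ℕ.≤-trans (ℕ.m⊓n≤n y _)) (foldr-⊓-lower x π)

  foldr-⊓-∈ : ∀ x π → foldr _⊓_ x π ∈ x ∷ π
  foldr-⊓-∈ x []      = here refl
  foldr-⊓-∈ x (y ∷ π) with ℕ.⊓-sel y (foldr _⊓_ x π) | foldr-⊓-∈ x π
  ... | inj₁ eq | _        = there (here eq)
  ... | inj₂ eq | here eq′ = here (trans eq eq′)
  ... | inj₂ eq | there i  = there (there (≡.subst (_∈ π) (sym eq) i))

  smallest-lower : ∀ π → All (smallest π ≤_) π
  smallest-lower []      = []
  smallest-lower (x ∷ π) = foldr-⊓-≤ x π ∷ foldr-⊓-lower x π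

  all-∈ : ∀ p {π x} → all p π ≡ true → x ∈ π → p x ≡ true
  all-∈ p {y ∷ π} eq (here refl) = proj₁ (∧-true (p y) _ eq)
  all-∈ p {y ∷ π} eq (there i)   = all-∈ p (proj₂ (∧-true (p y) _ eq)) i

  all-cong : ∀ {p p′ : ℕ → Bool} {π} → All (λ x → p x ≡ p′ x) π → all p π ≡ all p′ π
  all-cong []         = refl
  all-cong (eq ∷ eqs) = cong₂ _∧_ eq (all-cong eqs)

  ∈⇒≤sum : ∀ {x π} → x ∈ π → x ≤ sum π
  ∈⇒≤sum {π = y ∷ π} (here refl) = ℕ.m≤m+n y (sum π)
  ∈⇒≤sum {π = y ∷ π} (there i)   = ℕ.≤-trans (∈⇒≤sum i) (ℕ.m≤n+m (sum π) y)

  countOf-below : ∀ s π → All (s <_) π → countOf s π ≡ 0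
  countOf-below s []      []         = refl
  countOf-below s (x ∷ π) (s<x ∷ s<) rewrite ≢⇒≡ᵇ-false x s (λ x≡s → ℕ.<⇒≢ s<x (sym x≡s)) = countOf-below s π s<

  module BySmallest (ok : ℕ → ℕ → Bool) where

    allowed : ℕ → ℕ → Bool
    allowed s x = (s ≤ᵇ x) ∧ ok s x

    -- Counting s over partitions with all parts at least s equals counting it over those with
    -- smallest part s, as the others contain no s.
    smallestOccurrences : ℕ → ℕ → ℕ
    smallestOccurrences s = Enumeration.occurrences (allowed s) s

    allowed-below : ∀ s x → x < s → allowed s x ≡ false
    allowed-below s x x<s = cong (_∧ ok s x) (<⇒≤ᵇ-false x<s)

    allowed-above : ∀ s x → s ≤ x → allowed s x ≡ ok s x
    allowed-above s x s≤x = cong (_∧ ok s x) (≤⇒≤ᵇ s≤x)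

    -- Parts of size at least `suc s` are positive, and the first part of a partition of k is at
    -- most k, so the two tests differ only in conditions that hold anyway.
    valid-partition : ∀ s k x π → Enumeration.valid (allowed (suc s)) k k (x ∷ π) ≡ isPartitionOf k (x ∷ π) ∧ all (allowed (suc s)) (x ∷ π)
    valid-partition s k x π = cases (isPartitionOf k (x ∷ π)) refl
      where
        open Enumeration (allowed (suc s)) using (valid)

        cases : ∀ b → isPartitionOf k (x ∷ π) ≡ b → valid k k (x ∷ π) ≡ b ∧ all (allowed (suc s)) (x ∷ π)
        cases true eq
          with _ , eq′ ← ∧-true (allPositive (x ∷ π)) _ eq
          with noninc , total ← ∧-true (nonincreasing (x ∷ π)) _ eq′
          rewrite noninc | total
                | ≤⇒≤ᵇ (≡.subst (x ≤_) (≡ᵇ-true⇒≡ (x + sum π) k total) (ℕ.m≤m+n x (sum π))) = ∧-identityʳ _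
        cases false eq with valid k k (x ∷ π) in v
        ... | false = refl
        ... | true
          with hn , at ← ∧-true (headAtMost k (x ∷ π) ∧ nonincreasing (x ∷ π)) _ v
          with _ , noninc ← ∧-true (headAtMost k (x ∷ π)) _ hn
          with al , total ← ∧-true (all (allowed (suc s)) (x ∷ π)) _ at
          = contradiction (trans (sym eq) (cong₂ _∧_ (positive (x ∷ π) al) (cong₂ _∧_ noninc total))) λ ()
          where
            positive : ∀ π → all (allowed (suc s)) π ≡ true → allPositive π ≡ true
            positive []          _ = refl
            positive (zero ∷ π)  ()
            positive (suc y ∷ π) al = positive π (proj₂ (∧-true (allowed (suc s) (suc y)) _ al))

    module _ (c : ℕ → Bool) where

      -- One weight for all three statistics: `c` is constantly true for `spt` and `sptoPlus`, and
      -- for `sptoMinus` it tests that k plus the size of the triangular partition is m.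
      weight : List ℕ → ℕ
      weight π = if (isNonempty π ∧ all (ok (smallest π)) π) ∧ c (smallest π) then multSmallest π else 0

      contribution : List ℕ → ℕ → ℕ
      contribution π s = if c s then (if all (allowed s) π then countOf s π else 0) else 0

      contribution-smallest : ∀ x π → contribution (x ∷ π) (smallest (x ∷ π)) ≡ weight (x ∷ π)
      contribution-smallest x π = begin
        (if c σ then (if all (allowed σ) (x ∷ π) then n else 0) else 0)
          ≡⟨ if-∧ (c σ) _ ⟨
        (if c σ ∧ all (allowed σ) (x ∷ π) then n else 0)
          ≡⟨ cong (if_then n else 0) (trans (∧-comm (c σ) _) (cong (_∧ c σ) (all-cong (All.map (allowed-above σ _) (smallest-lower (x ∷ π)))))) ⟩
        weight (x ∷ π) ∎
        where
          σ = smallest (x ∷ π)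
          n = multSmallest (x ∷ π)

      -- If s is below the smallest part it does not occur; if it is above, the smallest part itself
      -- violates the lower bound.
      contribution-other : ∀ x π s → s ≢ smallest (x ∷ π) → contribution (x ∷ π) s ≡ 0
      contribution-other x π s s≢σ = trans (if-cong (c s) vanishes) (if-else-0 (c s))
        where
          σ = smallest (x ∷ π)
          vanishes : (if all (allowed s) (x ∷ π) then countOf s (x ∷ π) else 0) ≡ 0
          vanishes with ℕ.<-cmp s σ
          ... | tri< s<σ _ _ = trans (if-cong (all (allowed s) (x ∷ π)) (countOf-below s (x ∷ π) (All.map (ℕ.<-≤-trans s<σ) (smallest-lower (x ∷ π)))))
                                     (if-else-0 (all (allowed s) (x ∷ π)))
          ... | tri≈ _ s≡σ _ = contradiction s≡σ s≢σ
          ... | tri> _ _ σ<s with all (allowed s) (x ∷ π) in al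
          ...   | false = refl
          ...   | true  = contradiction (trans (sym (allowed-below s σ σ<s)) (all-∈ (allowed s) al (foldr-⊓-∈ x π))) λ ()

      Σ-contribution : ∀ {k K} → k ≤ K → ∀ x π → isPartitionOf k (x ∷ π) ≡ true → Σℕ K (λ ν → contribution (x ∷ π) (suc ν)) ≡ weight (x ∷ π)
      Σ-contribution {k} {K} k≤K x π partition = go (smallest (x ∷ π)) refl
        where
          bounded : smallest (x ∷ π) ≤ K
          bounded with _ , eq ← ∧-true (allPositive (x ∷ π)) _ partition
                  with _ , total ← ∧-true (nonincreasing (x ∷ π)) _ eq
            = ℕ.≤-trans (ℕ.≤-trans (∈⇒≤sum (foldr-⊓-∈ x π)) (ℕ.≤-reflexive (≡ᵇ-true⇒≡ _ k total))) k≤K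

          go : ∀ σ → smallest (x ∷ π) ≡ σ → Σℕ K (λ ν → contribution (x ∷ π) (suc ν)) ≡ weight (x ∷ π)
          go zero eq = contradiction (trans (sym (cong (1 ≤ᵇ_) eq))
            (all-∈ (1 ≤ᵇ_) (proj₁ (∧-true (allPositive (x ∷ π)) _ partition)) (foldr-⊓-∈ x π))) λ ()
          go (suc σ) eq = begin
            Σℕ K (λ ν → contribution (x ∷ π) (suc ν))
              ≡⟨ Σℕ-single K σ _ (≡.subst (_≤ K) eq bounded)
                   (λ i i≢σ → contribution-other x π (suc i) (λ i≡ → i≢σ (ℕ.suc-injective (trans i≡ eq)))) ⟩
            contribution (x ∷ π) (suc σ)               ≡⟨ cong (contribution (x ∷ π)) eq ⟨
            contribution (x ∷ π) (smallest (x ∷ π))    ≡⟨ contribution-smallest x π ⟩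
            weight (x ∷ π)                             ∎

      weight-split : ∀ {k K} → k ≤ K → ∀ π → (if isPartitionOf k π then weight π else 0) ≡
        Σℕ K (λ ν → if c (suc ν) then Enumeration.weigh (allowed (suc ν)) (countOf (suc ν)) k k π else 0)
      weight-split {k} {K} k≤K [] = trans (if-else-0 (isPartitionOf k [])) (sym (trans
        (Σℕ-cong K (λ ν → trans (if-cong (c (suc ν)) (if-else-0 (0 ≡ᵇ k))) (if-else-0 (c (suc ν))))) (Σℕ-0 K)))
      weight-split {k} {K} k≤K (x ∷ π) = begin
        (if p then weight (x ∷ π) else 0)
          ≡⟨ cases p refl ⟩
        (if p then Σℕ K (λ ν → contribution (x ∷ π) (suc ν)) else 0)
          ≡⟨ Σℕ-if K p _ ⟨
        Σℕ K (λ ν → if p then contribution (x ∷ π) (suc ν) else 0)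
          ≡⟨ Σℕ-cong K (λ ν → trans (if-swap p (c (suc ν)) _) (if-cong (c (suc ν)) (trans (sym (if-∧ p _))
               (cong (if_then countOf (suc ν) (x ∷ π) else 0) (sym (valid-partition ν k x π)))))) ⟩
        Σℕ K (λ ν → if c (suc ν) then Enumeration.weigh (allowed (suc ν)) (countOf (suc ν)) k k (x ∷ π) else 0) ∎
        where
          p = isPartitionOf k (x ∷ π)

          if-swap : ∀ a b (n : ℕ) → (if a then (if b then n else 0) else 0) ≡ (if b then (if a then n else 0) else 0)
          if-swap true  b     n = refl
          if-swap false true  n = refl
          if-swap false false n = refl

          cases : ∀ b → p ≡ b → (if b then weight (x ∷ π) else 0) ≡ (if b then Σℕ K (λ ν → contribution (x ∷ π) (suc ν)) else 0)
          cases true  eq = sym (Σ-contribution k≤K x π eq)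
          cases false eq = refl

      Σ-weight : ∀ {k K} → k ≤ K → Σ[ partitions k ] weight ≡ Σℕ K (λ ν → if c (suc ν) then smallestOccurrences (suc ν) k else 0)
      Σ-weight {k} {K} k≤K = begin
        Σᴸ (filterᵇ (isPartitionOf k) (candidates k)) weight
          ≡⟨ Σᴸ-filterᵇ (isPartitionOf k) (candidates k) weight ⟩
        Σᴸ (candidates k) (λ π → if isPartitionOf k π then weight π else 0)
          ≡⟨ Σᴸ-cong (candidates k) (weight-split k≤K) ⟩
        Σᴸ (candidates k) (λ π → Σℕ K (λ ν → if c (suc ν) then Enumeration.weigh (allowed (suc ν)) (countOf (suc ν)) k k π else 0))
          ≡⟨ Σᴸ-Σℕ (candidates k) K _ ⟩
        Σℕ K (λ ν → Σᴸ (candidates k) (λ π → if c (suc ν) then Enumeration.weigh (allowed (suc ν)) (countOf (suc ν)) k k π else 0))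
          ≡⟨ Σℕ-cong K (λ ν → Σᴸ-if (candidates k) (c (suc ν)) _) ⟩
        Σℕ K (λ ν → if c (suc ν) then smallestOccurrences (suc ν) k else 0) ∎

  module Plain = BySmallest (λ _ _ → true)
  module Admissible = BySmallest (λ s x → not (isOdd x) ∨ (x ≤ᵇ 2 ℕ.* s))

  nonempty-multSmallest : ∀ π → multSmallest π ≡ Plain.weight (λ _ → true) π
  nonempty-multSmallest []      = refl
  nonempty-multSmallest (x ∷ π) = cong (if_then multSmallest (x ∷ π) else 0) (sym (trans (∧-identityʳ _) (all-true π)))
    where
      all-true : ∀ π → all (λ _ → true) π ≡ true
      all-true []      = refl
      all-true (x ∷ π) = all-true π

  spt-occurrences : ∀ n → spt n ≡ Σℕ n (λ ν → Plain.smallestOccurrences (suc ν) n)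
  spt-occurrences n = trans (Σᴸ-cong (partitions n) nonempty-multSmallest) (Plain.Σ-weight (λ _ → true) {k = n} ℕ.≤-refl)

  sptoPlus-occurrences : ∀ m → sptoPlus m ≡ Σℕ m (λ ν → Admissible.smallestOccurrences (suc ν) m)
  sptoPlus-occurrences m = trans
    (Σᴸ-cong (partitions m) (λ π → cong (if_then multSmallest π else 0) (sym (∧-identityʳ (admissible π)))))
    (Admissible.Σ-weight (λ _ → true) {k = m} ℕ.≤-refl)

  C2-triangular : ∀ n → n C 2 ≡ triangular n
  C2-triangular zero    = refl
  C2-triangular (suc n) = begin
    suc n C 2          ≡⟨ nCk+nC[k+1]≡[n+1]C[k+1] n 1 ⟨
    n C 1 + n C 2      ≡⟨ cong₂ _+_ (nC1≡n n) (C2-triangular n) ⟩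
    n + triangular n   ≡⟨ ℕ.+-comm n _ ⟩
    triangular n + n   ∎

  -- With the sums over k and over the smallest part s interchanged, only k = m - s(s-1)/2 survives
  -- for each s, provided it is not negative.
  sptoMinus-occurrences : ∀ m → sptoMinus m ≡ Σℕ m (λ ν → if triangular (suc ν) ≤ᵇ m then Admissible.smallestOccurrences (suc ν) (m ∸ triangular (suc ν)) else 0)
  sptoMinus-occurrences m = begin
    sptoMinus m
      ≡⟨ Σᴸ-applyUpTo (λ k → k) (suc m) _ ⟩
    Σℕ (suc m) (λ k → Σ[ partitions k ] Admissible.weight (λ s → k + (s C 2) ≡ᵇ m))
      ≡⟨ Σℕ-cong< (suc m) (λ k k≤m → Admissible.Σ-weight (λ s → k + (s C 2) ≡ᵇ m) (ℕ.s≤s⁻¹ k≤m)) ⟩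
    Σℕ (suc m) (λ k → Σℕ m (λ ν → if k + (suc ν C 2) ≡ᵇ m then Admissible.smallestOccurrences (suc ν) k else 0))
      ≡⟨ Σℕ-swap (suc m) m _ ⟩
    Σℕ m (λ ν → Σℕ (suc m) (λ k → if k + (suc ν C 2) ≡ᵇ m then Admissible.smallestOccurrences (suc ν) k else 0))
      ≡⟨ Σℕ-cong m (λ ν → trans (Σℕ-cong (suc m) (λ k → cong (λ i → if i ≡ᵇ m then Admissible.smallestOccurrences (suc ν) k else 0)
           (trans (cong (_+_ k) (C2-triangular (suc ν))) (ℕ.+-comm k _)))) (select (triangular (suc ν)) (Admissible.smallestOccurrences (suc ν)))) ⟩
    _ ∎
    where
      select : ∀ t (f : ℕ → ℕ) → Σℕ (suc m) (λ k → if t + k ≡ᵇ m then f k else 0) ≡ (if t ≤ᵇ m then f (m ∸ t) else 0)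
      select t f = begin
        Σℕ (suc m) (λ k → if t + k ≡ᵇ m then f k else 0)
          ≡⟨ Σℕ-cong (suc m) (λ k → trans (cong (if_then f k else 0) (+-≡ᵇ t k m)) (if-∧ (t ≤ᵇ m) _)) ⟩
        Σℕ (suc m) (λ k → if t ≤ᵇ m then (if k ≡ᵇ m ∸ t then f k else 0) else 0)
          ≡⟨ Σℕ-if (suc m) (t ≤ᵇ m) _ ⟩
        (if t ≤ᵇ m then Σℕ (suc m) (λ k → if k ≡ᵇ m ∸ t then f k else 0) else 0)
          ≡⟨ if-cong (t ≤ᵇ m) (trans (Σℕ-single (suc m) (m ∸ t) _ (s≤s (ℕ.m∸n≤m m t))
               (λ i i≢ → cong (if_then f i else 0) (≢⇒≡ᵇ-false i (m ∸ t) i≢)))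
               (cong (if_then f (m ∸ t) else 0) (≡ᵇ-refl (m ∸ t)))) ⟩
        (if t ≤ᵇ m then f (m ∸ t) else 0) ∎

-- Coefficients of the ring-valued generating functions.

module Coefficients (N : ℕ) where

  open PowerSeries
  open Enumerations using (layerℕ)
  open FiniteSums ℕ.+-0-commutativeMonoid using () renaming (Σ< to Σℕ)
  open ≡ using (refl; cong; cong₂; module ≡-Reasoning)
  open Sums (truncatedSeries N) using (Σ<; _^_)
  open Layers (truncatedSeries N)

  -- Read along `ι`, multiplication by y^x is a shift by x. For y = q² only even degrees are read,
  -- so degree 2t speaks of partitions of t.
  Extracts : Series → (ℕ → ℕ) → Set
  Extracts y ι = ∀ x f t → (y ^ x ⊛ f) (ι t) ≡ (if x ≤ᵇ t then f (ι (t ℕ.∸ x)) else 0ℤ)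

  var-extracts : Extracts var (λ t → t)
  var-extracts zero    f t       = ⊛-identityˡ f t
  var-extracts (suc x) f zero    = ≡.trans (⊛-assoc var (var ^ x) f 0) (ℤ.*-zeroˡ ((var ^ x ⊛ f) 0))
  var-extracts (suc x) f (suc t) = begin
    (var ⊛ var ^ x ⊛ f) (suc t)                           ≡⟨ ⊛-assoc var (var ^ x) f (suc t) ⟩
    (var ⊛ (var ^ x ⊛ f)) (suc t)                         ≡⟨ var-⊛ (var ^ x ⊛ f) t ⟩
    (var ^ x ⊛ f) t                                       ≡⟨ var-extracts x f t ⟩
    (if x ≤ᵇ t then f (t ℕ.∸ x) else 0ℤ)                  ≡⟨ cong (λ k → if k then f (t ℕ.∸ x) else 0ℤ) (<ᵇ-suc x t) ⟨
    (if x <ᵇ suc t then f (t ℕ.∸ x) else 0ℤ)              ∎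
    where open ≡-Reasoning

  var²-extracts : Extracts (var ⊛ var) double
  var²-extracts zero    f t       = ⊛-identityˡ f (double t)
  var²-extracts (suc x) f zero    = ≡.trans (⊛-assoc (var ⊛ var) ((var ⊛ var) ^ x) f 0) (ℤ.*-zeroˡ (((var ⊛ var) ^ x ⊛ f) 0))
  var²-extracts (suc x) f (suc t) = begin
    (var ⊛ var ⊛ y^x ⊛ f) (double (suc t))                ≡⟨ ⊛-assoc (var ⊛ var) y^x f (double (suc t)) ⟩
    (var ⊛ var ⊛ (y^x ⊛ f)) (double (suc t))              ≡⟨ ⊛-assoc var var (y^x ⊛ f) (double (suc t)) ⟩
    (var ⊛ (var ⊛ (y^x ⊛ f))) (double (suc t))            ≡⟨ var-⊛ (var ⊛ (y^x ⊛ f)) (suc (double t)) ⟩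
    (var ⊛ (y^x ⊛ f)) (suc (double t))                    ≡⟨ var-⊛ (y^x ⊛ f) (double t) ⟩
    (y^x ⊛ f) (double t)                                  ≡⟨ var²-extracts x f t ⟩
    (if x ≤ᵇ t then f (double (t ℕ.∸ x)) else 0ℤ)         ≡⟨ cong (λ k → if k then f (double (t ℕ.∸ x)) else 0ℤ) (<ᵇ-suc x t) ⟨
    (if x <ᵇ suc t then f (double (t ℕ.∸ x)) else 0ℤ)     ∎
    where
      open ≡-Reasoning
      y^x = (var ⊛ var) ^ x

  var-nilpotent : ∀ i → i ≤ N → (var ^ suc N) i ≡ 0ℤ
  var-nilpotent i i≤N = begin
    (var ^ suc N) i                                   ≡⟨ ⊛-identityʳ (var ^ suc N) i ⟨
    (var ^ suc N ⊛ one) i                             ≡⟨ var-extracts (suc N) one i ⟩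
    (if suc N ≤ᵇ i then one (i ℕ.∸ suc N) else 0ℤ)    ≡⟨ cong (λ k → if k then one (i ℕ.∸ suc N) else 0ℤ) (<⇒≤ᵇ-false (s≤s i≤N)) ⟩
    0ℤ                                                ∎
    where open ≡-Reasoning

  Σ-coefficient : ∀ n (F : ℕ → Series) (f : ℕ → ℕ) t → (∀ i → F i t ≡ + f i) → Σ< n F t ≡ + Σℕ n f
  Σ-coefficient zero    F f t eq = refl
  Σ-coefficient (suc n) F f t eq = ≡.trans (cong₂ ℤ._+_ (Σ-coefficient n F f t eq) (eq n)) (≡.sym (ℤ.pos-+ (Σℕ n f) (f n)))

  ⌊⌋-coefficient : ∀ b f g t → (b ≡ true → f t ≡ + g) → (⌊ b ⌋ ⊛ f) t ≡ + (if b then g else 0)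
  ⌊⌋-coefficient true  f g t eq = ≡.trans (⊛-identityˡ f t) (eq refl)
  ⌊⌋-coefficient false f g t eq = ⊛-zeroˡ f t

  layer-coefficient : ∀ y ι → Extracts y ι → ∀ allowed source sourceℕ c cℕ →
    (∀ L b t → source L b (ι t) ≡ + sourceℕ L b t) → (∀ t → c (ι t) ≡ + cℕ t) →
    ∀ L b t → layer y allowed source c L b (ι t) ≡ + layerℕ allowed sourceℕ cℕ L b t
  layer-coefficient y ι extracts allowed source sourceℕ c cℕ source≡ c≡ = go
    where
      go : ∀ L b t → layer y allowed source c L b (ι t) ≡ + layerℕ allowed sourceℕ cℕ L b t
      go zero    b t = c≡ t
      go (suc L) b t = Σ-coefficient b _ _ (ι t) λ i → ⌊⌋-coefficient (allowed (suc i)) _ _ (ι t) λ _ →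
        ≡.trans (extracts (suc i) _ t) (branch (suc i ≤ᵇ t) (≡.trans
          (cong₂ ℤ._+_ (go L (suc i) (t ℕ.∸ suc i)) (source≡ L (suc i) (t ℕ.∸ suc i)))
          (≡.sym (ℤ.pos-+ (layerℕ allowed sourceℕ cℕ L (suc i) (t ℕ.∸ suc i)) _))))
        where
          branch : ∀ k {x n} → x ≡ + n → (if k then x else 0ℤ) ≡ + (if k then n else 0)
          branch true  eq = eq
          branch false eq = refl

-- Assembly of the series identity and the counts.

open Enumerations

module _ (s : ℕ) where

  admissible-middle : ∀ i → s ≤ i → i ≤ double s → Admissible.allowed s i ≡ true
  admissible-middle i s≤i i≤2s = ≡.trans (Admissible.allowed-above s i s≤i)
    (≡.trans (≡.cong (not (isOdd i) ∨_) (≤⇒≤ᵇ (≡.subst (i ≤_) (double≡2* s) i≤2s))) (∨-zeroʳ _))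

  admissible-odd : ∀ i → s ≤ i → Admissible.allowed s (suc (double i)) ≡ false
  admissible-odd i s≤i = ≡.trans (Admissible.allowed-above s _ (ℕ.m≤n⇒m≤1+n (ℕ.≤-trans s≤i (n≤double i))))
    (≡.cong₂ (λ a b → not a ∨ b) (isOdd-suc-double i) (<⇒≤ᵇ-false (≡.subst (_< suc (double i)) (double≡2* s) (s≤s (double-mono-≤ s≤i)))))

  admissible-even : ∀ i → s ≤ i → Admissible.allowed s (double i) ≡ true
  admissible-even i s≤i = ≡.trans (Admissible.allowed-above s _ (ℕ.≤-trans s≤i (n≤double i)))
    (≡.cong (λ a → not a ∨ (double i ≤ᵇ 2 ℕ.* s)) (isOdd-double i))

module GeneratingFunctions (R : CommutativeRing 0ℓ 0ℓ) where
  open Sums R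
  open QSeries R
  open Layers R
  open ClosedForms R

  module _ (q : Carrier) (n : ℕ) (q^≈0 : q ^ suc (double n) ≈ 0#) where

    open Nilpotent q (double n) q^≈0
    open Products q inverse inverse-correct

    private
      m = double n

    q²-vanishes : (q * q) ^ suc n ≈ 0#
    q²-vanishes = trans (*-^-double q (suc n)) (^-vanishes _ (s≤s (ℕ.n≤1+n _)))

    -- Admissible partitions in q and ordinary ones in q², each with smallest part ν + 1. Larger
    -- part bounds than m and n would change nothing, since q^(2n+1) = 0.
    Wₐ Wₛ : ℕ → Carrier
    Wₐ ν = Totals.W q (Admissible.allowed (suc ν)) (suc ν) (suc m) q^≈0 m
    Wₛ ν = Totals.W (q * q) (Plain.allowed (suc ν)) (suc ν) (suc n) q²-vanishes n

    -- The closed form requires part bound 2K with K ≥ s, and s can be as large as m. So K = m, and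
    -- the bound m is raised to 2m at no cost because the extra powers of q vanish.
    Q-Wₐ : ∀ ν → ν < m → Q m * Wₐ ν ≈ B (suc ν) * U (suc ν)
    Q-Wₐ ν ν<m = trans
      (*-congˡ (sym (Totals.W-beyond q (Admissible.allowed (suc ν)) (suc ν) (suc m) q^≈0 (λ i m≤i → ^-vanishes (suc i) (s≤s m≤i)) (n≤double m))))
      (Q-W-admissible q inverse inverse-correct (Admissible.allowed (suc ν)) ν (suc m) q^≈0
        (Admissible.allowed-below (suc ν)) (admissible-middle (suc ν)) (admissible-odd (suc ν)) (admissible-even (suc ν)) m ν<m)

    -- Reconciles the two multipliers: the admissible side needs `Q m`, the ordinary side naturally
    -- gives `Q n`, and the factors between them are 1.
    Q-stable : ∀ {k} → n ≤ k → Q k ≈ Q n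
    Q-stable n≤k = go (ℕ.≤⇒≤′ n≤k)
      where
        go : ∀ {k} → n ℕ.≤′ k → Q k ≈ Q n
        go ℕ.≤′-refl = refl
        go (ℕ.≤′-step {k} n≤′k) = begin
          Q k * (1# - q ^ double (suc k))  ≈⟨ *-congˡ (+-congˡ (-‿cong (^-vanishes _ (s≤s (ℕ.m≤n⇒m≤1+n (double-mono-≤ (ℕ.≤′⇒≤ n≤′k))))))) ⟩
          Q k * (1# - 0#)                  ≈⟨ solve 1 (λ x → x :* (:1 :- con 0ℤ) := x) refl _ ⟩
          Q k                              ≈⟨ go n≤′k ⟩
          Q n                              ∎

    Q-Wₛ : ∀ ν → ν < n → Q m * Wₛ ν ≈ T ν
    Q-Wₛ ν ν<n = trans (*-congʳ (Q-stable (n≤double n)))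
      (Q-W-spt q inverse inverse-correct (q * q) (*-^-double q) (Plain.allowed (suc ν)) ν (suc n) q²-vanishes
        (Plain.allowed-below (suc ν)) (Plain.allowed-above (suc ν)) n ν<n)

    cancel-Q : ∀ {x y} → Q m * x ≈ Q m * y → x ≈ y
    cancel-Q {x} {y} Qx≈Qy = begin
      x                   ≈⟨ unit x ⟨
      V m * (Q m * x)   ≈⟨ *-congˡ Qx≈Qy ⟩
      V m * (Q m * y)   ≈⟨ unit y ⟩
      y                   ∎
      where
        unit : ∀ z → V m * (Q m * z) ≈ z
        unit z = trans (solve 3 (λ v q z → v :* (q :* z) := q :* v :* z) refl _ _ z)
          (trans (*-congʳ (QV≈1 m)) (*-identityˡ z))

    -- Free of subtraction, so that every coefficient is the image of a natural number and
    -- `Σ-coefficient` applies on both sides.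
    spto-series : Σ< n Wₛ + Σ< m (λ ν → q ^ triangular (suc ν) * Wₐ ν) ≈ Σ< m Wₐ
    spto-series = begin
      Σ< n Wₛ + Σ< m (λ ν → q ^ triangular (suc ν) * Wₐ ν)
        ≈⟨ +-congʳ (cancel-Q key) ⟨
      Σ< m (λ ν → Wₐ ν * (1# - q ^ triangular (suc ν))) + Σ< m (λ ν → q ^ triangular (suc ν) * Wₐ ν)
        ≈⟨ Σ-+ m _ _ ⟨
      Σ< m (λ ν → Wₐ ν * (1# - q ^ triangular (suc ν)) + q ^ triangular (suc ν) * Wₐ ν)
        ≈⟨ Σ-cong m (λ ν → solve 2 (λ w x → w :* (:1 :- x) :+ x :* w := w) refl _ _) ⟩
      Σ< m Wₐ ∎
      where
        key : Q m * Σ< m (λ ν → Wₐ ν * (1# - q ^ triangular (suc ν))) ≈ Q m * Σ< n Wₛ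
        key = begin
          Q m * Σ< m (λ ν → Wₐ ν * (1# - q ^ triangular (suc ν)))
            ≈⟨ *-distribˡ-Σ m _ _ ⟩
          Σ< m (λ ν → Q m * (Wₐ ν * (1# - q ^ triangular (suc ν))))
            ≈⟨ Σ-cong< m (λ ν ν<m → trans (sym (*-assoc _ _ _)) (*-congʳ (Q-Wₐ ν ν<m))) ⟩
          Σ< m (λ ν → B (suc ν) * U (suc ν) * (1# - q ^ triangular (suc ν)))
            ≈⟨ spt-identity n q^≈0 ⟩
          Σ< n T
            ≈⟨ Σ-cong< n Q-Wₛ ⟨
          Σ< n (λ ν → Q m * Wₛ ν)
            ≈⟨ *-distribˡ-Σ n _ _ ⟨
          Q m * Σ< n Wₛ ∎

module _ (n : ℕ) where
  private
    m = double n
  open PowerSeries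
  open ≡ using (cong; cong₂)
  open Sums (truncatedSeries m) using (_^_; Σ<)
  open Layers (truncatedSeries m)
  open Coefficients m
  open GeneratingFunctions (truncatedSeries m)

  marked-coefficient : ∀ y ι → Extracts y ι → (∀ t → one (ι t) ≡ + (if 0 ≡ᵇ t then 1 else 0)) → ∀ allowed s L b t →
    Marked.marked y allowed s L b (ι t) ≡ + Enumeration.markedℕ allowed s L b t
  marked-coefficient y ι extracts one-ι allowed s =
    layer-coefficient y ι extracts allowed _ _ _ _
      (λ L b t → ⌊⌋-coefficient (b ≡ᵇ s) _ _ (ι t) (λ _ →
        layer-coefficient y ι extracts allowed no-source (Enumeration.noSource allowed) _ _ (λ _ _ _ → ≡.refl) one-ι L b t))
      (λ _ → ≡.refl)

  one-coefficient : ∀ t → one t ≡ + (if 0 ≡ᵇ t then 1 else 0)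
  one-coefficient zero    = ≡.refl
  one-coefficient (suc t) = ≡.refl

  one-double : ∀ t → one (double t) ≡ + (if 0 ≡ᵇ t then 1 else 0)
  one-double zero    = ≡.refl
  one-double (suc t) = ≡.refl

  Wₐ-coefficient : ∀ ν k → k ≤ m → Wₐ var n var-nilpotent ν k ≡ + Admissible.smallestOccurrences (suc ν) k
  Wₐ-coefficient ν k k≤m = ≡.trans
    (Σ-coefficient (suc m) _ _ k (λ L → marked-coefficient var (λ t → t) var-extracts one-coefficient (Admissible.allowed (suc ν)) (suc ν) L m k))
    (cong +_ (≡.sym (Enumeration.occurrences-markedℕ (Admissible.allowed (suc ν)) (suc ν) k≤m)))

  Wₛ-coefficient : ∀ ν → Wₛ var n var-nilpotent ν (double n) ≡ + Plain.smallestOccurrences (suc ν) n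
  Wₛ-coefficient ν = ≡.trans
    (Σ-coefficient (suc n) _ _ (double n) (λ L → marked-coefficient (var ⊛ var) double var²-extracts one-double (Plain.allowed (suc ν)) (suc ν) L n n))
    (cong +_ (≡.sym (Enumeration.occurrences-markedℕ (Plain.allowed (suc ν)) (suc ν) {n} ℕ.≤-refl)))

  -- The coefficient of q^m in `spto-series`, the highest one that truncation at degree m retains.
  spt+sptoMinus : + spt n ℤ.+ + sptoMinus m ≡ + sptoPlus m
  spt+sptoMinus = begin
    + spt n ℤ.+ + sptoMinus m
      ≡⟨ cong₂ ℤ._+_ (cong +_ (spt-occurrences n)) (cong +_ (sptoMinus-occurrences m)) ⟩
    _
      ≡⟨ cong₂ ℤ._+_ (Σ-coefficient n _ _ m Wₛ-coefficient)
           (Σ-coefficient m _ _ m (λ ν → ≡.trans (var-extracts (triangular (suc ν)) (Wₐ var n var-nilpotent ν) m) (branch (triangular (suc ν) ≤ᵇ m) (Wₐ-coefficient ν _ (ℕ.m∸n≤m m (triangular (suc ν))))))) ⟨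
    Σ< n (Wₛ var n var-nilpotent) m ℤ.+ Σ< m (λ ν → var ^ triangular (suc ν) ⊛ Wₐ var n var-nilpotent ν) m
      ≡⟨ spto-series var n var-nilpotent m ℕ.≤-refl ⟩
    Σ< m (Wₐ var n var-nilpotent) m
      ≡⟨ Σ-coefficient m _ _ m (λ ν → Wₐ-coefficient ν m ℕ.≤-refl) ⟩
    _
      ≡⟨ cong +_ (sptoPlus-occurrences m) ⟨
    + sptoPlus m ∎
    where
      open ≡.≡-Reasoning
      branch : ∀ k {x i} → x ≡ + i → (if k then x else 0ℤ) ≡ + (if k then i else 0)
      branch true  eq = eq
      branch false eq = ≡.refl

open import Data.Nat using (_*_; _≥_)

theorem2 : (n : ℕ) → n ≥ 1 → spto (2 * n) ≡ + spt n
theorem2 n _ = begin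
  spto (2 * n)                                               ≡⟨ ≡.cong spto (double≡2* n) ⟨
  + sptoPlus m ℤ.- + sptoMinus m                             ≡⟨ ≡.cong (ℤ._- + sptoMinus m) (spt+sptoMinus n) ⟨
  + spt n ℤ.+ + sptoMinus m ℤ.- + sptoMinus m                ≡⟨ ℤ.+-assoc (+ spt n) (+ sptoMinus m) (ℤ.- + sptoMinus m) ⟩
  + spt n ℤ.+ (+ sptoMinus m ℤ.- + sptoMinus m)              ≡⟨ ≡.cong (ℤ._+_ (+ spt n)) (ℤ.+-inverseʳ (+ sptoMinus m)) ⟩
  + spt n ℤ.+ 0ℤ                                             ≡⟨ ℤ.+-identityʳ _ ⟩
  + spt n                                                    ∎
  where
    open ≡.≡-Reasoning
    m = double n
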